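{- For every integer $q \geq 2$, there exists a (polynomial-time) kernelization algorithm for the Storage Capacity$_q$ problem, which given an instance $(G,k)$ (a graph $G$ and an integer $k \geq 0$) returns an equivalent instance $(G',k')$, where $G'$ has at most $\max(3k'-3,0)$ vertices and $k' \leq k$. Here equivalence means that $\mathrm{Cap}_q(G) \geq k$ if and only if $\mathrm{Cap}_q(G') \geq k'$.
   Context: All graphs are finite, undirected and simple; the graph $K_0$ with no vertices and no edges is allowed. $N_G(i)$ denotes the set of vertices adjacent to $i$ in $G$ (so $i \notin N_G(i)$), $[n]=\{1,\dots,n\}$, and $x_S$ denotes the restriction of a vector $x$ to the entries with indices in $S$. Storage capacity: for a graph $G$ on the vertex set $[n]$ and an integer $q \geq 2$, $\mathrm{Cap}_q(G)$ is the maximum of $\log_q |C|$ over all codes $C \subseteq [q]^n$ such that for every codeword $x \in C$ and every vertex $i \in [n]$, the value of $x_i$ can be determined from $x_{N_G(i)}$ (i.e., for all $x,y \in C$ and $i \in [n]$, $x_{N_G(i)} = y_{N_G(i)}$ implies $x_i=y_i$). For a graph on an arbitrary $n$-element vertex set, identify the vertex set with $[n]$; in particular $\mathrm{Cap}_q(K_0)=0$. The Storage Capacity$_q$ problem: given a graph $G$ and an integer $k \geq 0$, decide whether $\mathrm{Cap}_q(G) \geq k$; the parameter is $k$. A kernelization algorithm for a parameterized problem $L$ is an algorithm that, given an instance $(x,k)$, runs in polynomial time and returns an instance $(x',k')$ with $|x'|,k' \leq h(k)$ for some computable function $h:\mathbb{N}\to\mathbb{N}$, such that $(x,k) \in L$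 if and only if $(x',k') \in L$ (the instances are then called equivalent). -}

module Defs where

open import Data.Bool using (Bool; true; false)
open import Data.Fin using (Fin; finToFun)
open import Data.Fin.Subset using (Subset; _∈_; ∣_∣)
open import Data.List using (List; foldr; replicate; tabulate)
open import Data.Nat using (ℕ; suc; _+_; _*_; _^_; _≤_)
open import Data.Product using (∃-syntax; _×_; _,_)
open import Function.Bundles using (_⇔_)
open import Relation.Binary.PropositionalEquality using (_≡_)

------------------------------------------------------------------------
-- Model of computation
--
-- Programs are those of a small FP-style language (Backus) with `while`,
-- acting on binary trees, the data of Jones' WHILE language.  Evaluating
-- any program construct on x costs size x, plus the costs of its parts.
-- A result is therefore never larger than the cost of producing it, so a
-- Turing machine simulates a run of cost t in time polynomial in t.
-- Conversely a Turing machine, its tape stored as two list-like trees, is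
-- simulated by one `while`.  Hence polynomial cost here is the usual
-- polynomial time.

data Tree : Set where
  leaf : Tree
  node : Tree → Tree → Tree

size : Tree → ℕ
size leaf       = 1
size (node l r) = suc (size l + size r)

infixr 9 _⊚_

data Program : Set where
  copy nil hd tl : Program
  _⊚_ cons while : Program → Program → Program
  if             : Program → Program → Program → Program

-- p ⊢ x ⇓ y [ t ]: on input x, p halts with output y at cost t.
-- As tests, `leaf` means false and every `node` means true.

infix 4 _⊢_⇓_[_]

data _⊢_⇓_[_] : Program → Tree → Tree → ℕ → Set where
  copy⇓   : ∀ {x} → copy ⊢ x ⇓ x [ size x ]
  nil⇓    : ∀ {x} → nil ⊢ x ⇓ leaf [ size x ]
  hd-leaf : hd ⊢ leaf ⇓ leaf [ 1 ]
  hd-node : ∀ {l r} → hd ⊢ node l r ⇓ l [ size (node l r) ]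
  tl-leaf : tl ⊢ leaf ⇓ leaf [ 1 ]
  tl-node : ∀ {l r} → tl ⊢ node l r ⇓ r [ size (node l r) ]
  ⊚⇓      : ∀ {p q x y z s t} →
            p ⊢ x ⇓ y [ s ] → q ⊢ y ⇓ z [ t ] →
            q ⊚ p ⊢ x ⇓ z [ size x + s + t ]
  cons⇓   : ∀ {p q x y z s t} →
            p ⊢ x ⇓ y [ s ] → q ⊢ x ⇓ z [ t ] →
            cons p q ⊢ x ⇓ node y z [ size x + s + t ]
  if-then : ∀ {b p q x l r y s t} →
            b ⊢ x ⇓ node l r [ s ] → p ⊢ x ⇓ y [ t ] →
            if b p q ⊢ x ⇓ y [ size x + s + t ]
  if-else : ∀ {b p q x y s t} →
            b ⊢ x ⇓ leaf [ s ] → q ⊢ x ⇓ y [ t ] →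
            if b p q ⊢ x ⇓ y [ size x + s + t ]
  while-stop : ∀ {b p x s} →
            b ⊢ x ⇓ leaf [ s ] →
            while b p ⊢ x ⇓ x [ size x + s ]
  while-step : ∀ {b p x l r y z s t u} →
            b ⊢ x ⇓ node l r [ s ] → p ⊢ x ⇓ y [ t ] →
            while b p ⊢ y ⇓ z [ u ] →
            while b p ⊢ x ⇓ z [ size x + s + t + u ]

encodeBool : Bool → Tree
encodeBool false = leaf
encodeBool true  = node leaf leaf

encodeList : List Tree → Tree
encodeList = foldr node leaf

encodeℕ : ℕ → Tree
encodeℕ n = encodeList (replicate n leaf)

Computable : (ℕ → ℕ) → Set
Computable h =
  ∃[ p ] (∀ n → ∃[ t ] p ⊢ encodeℕ n ⇓ encodeℕ (h n) [ t ])

------------------------------------------------------------------------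
-- Parameterized problems and kernelization

record ParameterizedProblem : Set₁ where
  field
    Input  : Set
    encode : Input → Tree
    Yes    : Input → ℕ → Set

  Instance : Set
  Instance = Input × ℕ

  -- The parameter is written in unary: as usual in parameterized
  -- complexity, the size of an instance (x , k) is of the order |x| + k.
  encodeInstance : Instance → Tree
  encodeInstance (x , k) = node (encode x) (encodeℕ k)

record Kernelization (L : ParameterizedProblem) : Set where
  open ParameterizedProblem L
  field
    program  : Program
    kernel   : Instance → Instance
    -- Sizes are at least 1, so the bounds c * size ^ d dominate all
    -- polynomials in the size.
    polytime : ∃[ c ] ∃[ d ] (∀ I → ∃[ t ]
                 (program ⊢ encodeInstance I ⇓ encodeInstance (kernel I) [ t ]
                   × t ≤ c * size (encodeInstance I) ^ d))
    bounded  : ∃[ h ] (Computable h × (∀ x k →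
                 let (x′ , k′) = kernel (x , k) in
                 size (encode x′) ≤ h k × k′ ≤ h k))
    equivalent : ∀ x k →
                 let (x′ , k′) = kernel (x , k) in
                 Yes x k ⇔ Yes x′ k′

------------------------------------------------------------------------
-- Graphs

record Graph : Set where
  field
    order     : ℕ
    adjacent  : Fin order → Fin order → Bool
    symmetric : ∀ i j → adjacent i j ≡ adjacent j i
    loopless  : ∀ i → adjacent i i ≡ false

open Graph public

-- The adjacency matrix, as a list of rows.
encodeGraph : Graph → Tree
encodeGraph G =
  encodeList (tabulate λ i → encodeList (tabulate λ j →
    encodeBool (adjacent G i j)))

------------------------------------------------------------------------
-- Storage capacity

-- Words of [q]ⁿ are the elements of Fin (q ^ n), read as functions
-- Fin n → Fin q through the bijection finToFun; codes are thus subsets of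
-- Fin (q ^ n).
Code : ℕ → Graph → Set
Code q G = Subset (q ^ order G)

letter : ∀ {q} (G : Graph) → Fin (q ^ order G) → Fin (order G) → Fin q
letter G = finToFun

IsStorageCode : ∀ q (G : Graph) → Code q G → Set
IsStorageCode q G C =
  ∀ x y → x ∈ C → y ∈ C → ∀ i →
  (∀ j → adjacent G i j ≡ true → letter {q} G x j ≡ letter {q} G y j) →
  letter {q} G x i ≡ letter {q} G y i

IsMaxCodeSize : ℕ → Graph → ℕ → Set
IsMaxCodeSize q G M =
  (∃[ C ] (IsStorageCode q G C × ∣ C ∣ ≡ M)) ×
  (∀ C → IsStorageCode q G C → ∣ C ∣ ≤ M)

-- Cap_q(G) ≥ k.  The capacity is log_q M for the maximum size M ≥ 1 of a
-- storage code, and for q ≥ 2 the inequality log_q M ≥ k between reals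
-- means q ^ k ≤ M.
Cap≥ : ℕ → Graph → ℕ → Set
Cap≥ q G k = ∃[ M ] (IsMaxCodeSize q G M × q ^ k ≤ M)

StorageCapacity : ℕ → ParameterizedProblem
StorageCapacity q = record
  { Input  = Graph
  ; encode = encodeGraph
  ; Yes    = Cap≥ q
  }

module Submission where

-- If k disjoint edges exist then Cap(G) ≥ k, because the two ends of each edge
-- may carry the same free letter.  Let M be a maximal matching with fewer than k
-- edges; the set I of unmatched vertices is independent.  Assign the ends of M
-- to I by an auction: an unserved vertex of I buys its cheapest neighbour, whose
-- price then rises by one, and gives up if all its neighbours cost at least |G|.
-- If everyone is served there are |I| disjoint edges, so either k of them or at
-- most 2(k-1) + (k-1) vertices.  Otherwise some price j between 1 and |G| is not
-- attained, since there are fewer items than prices.  A buyer has paid at most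
-- what each of his neighbours costs now, so the set H of items dearer than j
-- contains all neighbours of their buyers and of the unserved vertex: a crown.
-- Fixing the letters on H costs at most |H| of the capacity and leaves the
-- buyers without information, while the edges from H to its buyers add |H| to
-- the capacity of the rest.  Hence H, its buyers and the unserved vertex can be
-- deleted with k reduced by |H|, and the procedure is iterated.

open import Defs
open import Data.Bool as Bool using (Bool; true; false; if_then_else_; not; _∧_; _∨_; T)
open import Data.Bool.Properties using (T-≡)
open import Data.Fin as Fin using (Fin; zero; suc; toℕ; fromℕ<; funToFin)
import Data.Fin.Properties as Fin
open import Data.Fin.Properties using (toℕ-injective; toℕ<n; toℕ-fromℕ<; funToFin-finToFin; finToFun-funToFin)
open import Data.Fin.Subset as Subset using (Subset; inside; outside; ∣_∣)
open import Data.Fin.Subset.Properties as Subset using (anySubset?; ∣p∣≤n)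
open import Data.List using (List; []; _∷_; _++_; map; foldr; foldl; concatMap; filter; replicate; length; reverse;
  cartesianProduct; downFrom; drop; allFin; tabulate; lookup)
open import Data.List.Properties using (reverse-involutive; reverse-foldr; ++-is-foldr; drop-[]; length-downFrom;
  length-map; length-++; length-tabulate; ++-identityʳ; filter-accept; filter-reject; map-tabulate; tabulate-cong;
  tabulate-lookup)
open import Data.List.Membership.Propositional using (_∈_; _∉_; find)
open import Data.List.Membership.Propositional.Properties
open import Data.List.Relation.Unary.All as All using (All; []; _∷_)
import Data.List.Relation.Unary.All.Properties as All
open import Data.List.Relation.Unary.AllPairs as AllPairs using (AllPairs; []; _∷_)
import Data.List.Relation.Unary.AllPairs.Properties as AllPairs
import Data.List.Relation.Unary.Any.Properties as Any
open import Data.List.Relation.Unary.Any as Any using (Any; here; there; any?)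
open import Data.List.Relation.Unary.Unique.Propositional using (Unique)
import Data.List.Relation.Unary.Unique.Propositional.Properties as Unique
open import Data.Nat
open import Data.Nat.Properties
open import Data.Nat.Solver using (module +-*-Solver)
open import Data.List.Membership.DecPropositional _≟_ using (_∈?_)
open import Data.Product using (Σ-syntax; ∃-syntax; ∃₂; _×_; _,_; proj₁; proj₂)
open import Data.Sum using (_⊎_; inj₁; inj₂; [_,_]′)
open import Data.Unit using (⊤; tt)
import Data.Vec as Vec
import Data.Vec.Properties as Vec
open import Function using (_∘_; id; Equivalence; _⇔_; mk⇔)
open import Relation.Nullary using (¬_; Dec; does; yes; no; ¬?; contradiction; _×-dec_; _→-dec_; isYes; toWitness;
  fromWitness; decidable-stable)
open import Relation.Nullary.Decidable using (T?)
open import Relation.Unary using (Decidable)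
open import Relation.Binary.PropositionalEquality hiding ([_]; J)

open +-*-Solver using (solve; _:+_; _:*_; _:=_; con)

-- Polynomial-time computable functions

-- The kernelization must come with a program and a polynomial cost bound, and this shapes the
-- algorithm. Instead of augmenting paths, which rewrite a matching, the auction keeps a history of
-- bids that only grows, by one bounded item at a time; loops of this kind have polynomial states
-- for an evident reason. With a bidder present there are fewer than n items, each priced at most n,
-- hence fewer than n * n bids.
--
-- Bidding in units of one has a price: a buyer's item may cost one more than another neighbour of
-- his. The unattained price j absorbs exactly this error, since for items costing at least j and
-- costing more than j coincide.
--
-- Vertices are kept as a list of numbers, and words assign letters to all numbers, so that deleting
-- vertices renames nothing; graphs on `Fin n` enter only at both ends. Each reduction deletes at
-- least the unserved vertex, so as many rounds as vertices suffice. Instances known to be positive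
-- become the empty graph with parameter 0, and truncated subtraction turns 3k - 3 into the maximum
-- with 0.

infixl 6 _⊕_
infixl 7 _⊗_

-- Syntax for polynomials with natural coefficients: they are monotone, and substitution accounts
-- for the cost of running a program on the output of another.
data Poly : Set where
  ♯       : ℕ → Poly
  var     : Poly
  _⊕_ _⊗_ : Poly → Poly → Poly

⟦_⟧ : Poly → ℕ → ℕ
⟦ ♯ c ⟧   n = c
⟦ var ⟧   n = n
⟦ P ⊕ Q ⟧ n = ⟦ P ⟧ n + ⟦ Q ⟧ n
⟦ P ⊗ Q ⟧ n = ⟦ P ⟧ n * ⟦ Q ⟧ n

infixl 8 _⟨_⟩

_⟨_⟩ : Poly → Poly → Poly
♯ c     ⟨ R ⟩ = ♯ c
var     ⟨ R ⟩ = R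
(P ⊕ Q) ⟨ R ⟩ = P ⟨ R ⟩ ⊕ Q ⟨ R ⟩
(P ⊗ Q) ⟨ R ⟩ = P ⟨ R ⟩ ⊗ Q ⟨ R ⟩

⟦⟧-subst : ∀ P R n → ⟦ P ⟨ R ⟩ ⟧ n ≡ ⟦ P ⟧ (⟦ R ⟧ n)
⟦⟧-subst (♯ c)   R n = refl
⟦⟧-subst var     R n = refl
⟦⟧-subst (P ⊕ Q) R n = cong₂ _+_ (⟦⟧-subst P R n) (⟦⟧-subst Q R n)
⟦⟧-subst (P ⊗ Q) R n = cong₂ _*_ (⟦⟧-subst P R n) (⟦⟧-subst Q R n)

⟦⟧-mono : ∀ P {m n} → m ≤ n → ⟦ P ⟧ m ≤ ⟦ P ⟧ n
⟦⟧-mono (♯ c)   m≤n = ≤-refl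
⟦⟧-mono var     m≤n = m≤n
⟦⟧-mono (P ⊕ Q) m≤n = +-mono-≤ (⟦⟧-mono P m≤n) (⟦⟧-mono Q m≤n)
⟦⟧-mono (P ⊗ Q) m≤n = *-mono-≤ (⟦⟧-mono P m≤n) (⟦⟧-mono Q m≤n)

-- For a sum both exponents are raised to `d + d′`, which is where `1 ≤ n` enters.
⟦⟧-monomial : ∀ P → ∃[ c ] ∃[ d ] (∀ n → 1 ≤ n → ⟦ P ⟧ n ≤ c * n ^ d)
⟦⟧-monomial (♯ c) = c , 0 , λ n _ → ≤-reflexive (sym (*-identityʳ c))
⟦⟧-monomial var   = 1 , 1 , λ n _ → ≤-reflexive (sym (trans (*-identityˡ (n ^ 1)) (*-identityʳ n)))
⟦⟧-monomial (P ⊕ Q) with ⟦⟧-monomial P | ⟦⟧-monomial Q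
... | c , d , P≤ | c′ , d′ , Q≤ = c + c′ , d + d′ , bound
  where
  open ≤-Reasoning
  bound : ∀ n → 1 ≤ n → ⟦ P ⟧ n + ⟦ Q ⟧ n ≤ (c + c′) * n ^ (d + d′)
  bound n@(suc _) n≥1 = begin
    ⟦ P ⟧ n + ⟦ Q ⟧ n                        ≤⟨ +-mono-≤ (P≤ n n≥1) (Q≤ n n≥1) ⟩
    c * n ^ d + c′ * n ^ d′                  ≤⟨ +-mono-≤ (*-monoʳ-≤ c (^-monoʳ-≤ n (m≤m+n d d′)))
                                                         (*-monoʳ-≤ c′ (^-monoʳ-≤ n (m≤n+m d′ d))) ⟩
    c * n ^ (d + d′) + c′ * n ^ (d + d′)     ≡⟨ *-distribʳ-+ (n ^ (d + d′)) c c′ ⟨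
    (c + c′) * n ^ (d + d′)                  ∎
⟦⟧-monomial (P ⊗ Q) with ⟦⟧-monomial P | ⟦⟧-monomial Q
... | c , d , P≤ | c′ , d′ , Q≤ = c * c′ , d + d′ , bound
  where
  open ≤-Reasoning
  bound : ∀ n → 1 ≤ n → ⟦ P ⟧ n * ⟦ Q ⟧ n ≤ (c * c′) * n ^ (d + d′)
  bound n n≥1 = begin
    ⟦ P ⟧ n * ⟦ Q ⟧ n             ≤⟨ *-mono-≤ (P≤ n n≥1) (Q≤ n n≥1) ⟩
    (c * n ^ d) * (c′ * n ^ d′)   ≡⟨ [m*n]*[o*p]≡[m*o]*[n*p] c (n ^ d) c′ (n ^ d′) ⟩
    (c * c′) * (n ^ d * n ^ d′)   ≡⟨ cong (c * c′ *_) (^-distribˡ-+-* n d d′) ⟨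
    (c * c′) * n ^ (d + d′)       ∎

size≥1 : ∀ x → 1 ≤ size x
size≥1 leaf       = ≤-refl
size≥1 (node _ _) = s≤s z≤n

-- A cost bound is thereby also a bound on the size of the result, so that one polynomial serves for
-- both when programs are composed.
output≤cost : ∀ {p x y t} → p ⊢ x ⇓ y [ t ] → size y ≤ t
output≤cost copy⇓   = ≤-refl
output≤cost {x = x} nil⇓ = size≥1 x
output≤cost hd-leaf = ≤-refl
output≤cost (hd-node {l} {r}) = m≤n⇒m≤1+n (m≤m+n (size l) (size r))
output≤cost tl-leaf = ≤-refl
output≤cost (tl-node {l} {r}) = m≤n⇒m≤1+n (m≤n+m (size r) (size l))
output≤cost (⊚⇓ _ q) = m≤n⇒m≤o+n _ (output≤cost q)
output≤cost {x = x} (cons⇓ {s = s} {t} p q) =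
  ≤-trans (+-mono-≤ (size≥1 x) (+-mono-≤ (output≤cost p) (output≤cost q)))
          (≤-reflexive (sym (+-assoc (size x) s t)))
output≤cost (if-then _ p) = m≤n⇒m≤o+n _ (output≤cost p)
output≤cost (if-else _ q) = m≤n⇒m≤o+n _ (output≤cost q)
output≤cost {x = x} (while-stop {s = s} _) = m≤m+n (size x) s
output≤cost (while-step _ _ w) = m≤n⇒m≤o+n _ (output≤cost w)

infix 4 _⊢_⇓_within_

_⊢_⇓_within_ : Program → Tree → Tree → ℕ → Set
p ⊢ x ⇓ y within n = ∃[ t ] (p ⊢ x ⇓ y [ t ] × t ≤ n)

module _ {x Z} (x≤Z : size x ≤ Z) where

  ⊚-within : ∀ {p q y z m n} → p ⊢ x ⇓ y within m → q ⊢ y ⇓ z within n →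
             q ⊚ p ⊢ x ⇓ z within Z + m + n
  ⊚-within (_ , p , s≤) (_ , q , t≤) = _ , ⊚⇓ p q , +-mono-≤ (+-mono-≤ x≤Z s≤) t≤

  cons-within : ∀ {p q y z m n} → p ⊢ x ⇓ y within m → q ⊢ x ⇓ z within n →
                cons p q ⊢ x ⇓ node y z within Z + m + n
  cons-within (_ , p , s≤) (_ , q , t≤) = _ , cons⇓ p q , +-mono-≤ (+-mono-≤ x≤Z s≤) t≤

node≤⇒left≤ : ∀ l r {Z} → size (node l r) ≤ Z → size l ≤ Z
node≤⇒left≤ _ _ = ≤-trans (m≤n⇒m≤1+n (m≤m+n _ _))

node≤⇒right≤ : ∀ l r {Z} → size (node l r) ≤ Z → size r ≤ Z
node≤⇒right≤ l _ = ≤-trans (m≤n⇒m≤1+n (m≤n+m _ (size l)))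

hd-within : ∀ {l r Z} → size (node l r) ≤ Z → hd ⊢ node l r ⇓ l within Z
hd-within ≤Z = _ , hd-node , ≤Z

tl-within : ∀ {l r Z} → size (node l r) ≤ Z → tl ⊢ node l r ⇓ r within Z
tl-within ≤Z = _ , tl-node , ≤Z

record Encodable (A : Set) : Set where
  field ⌜_⌝ : A → Tree

open Encodable {{...}} public

⟪_⟫ : {A : Set} {{_ : Encodable A}} → A → ℕ
⟪ a ⟫ = size ⌜ a ⌝

instance
  encodable-⊤ : Encodable ⊤
  encodable-⊤ = record { ⌜_⌝ = λ _ → leaf }

  encodable-Bool : Encodable Bool
  encodable-Bool = record { ⌜_⌝ = encodeBool }

  encodable-ℕ : Encodable ℕ
  encodable-ℕ = record { ⌜_⌝ = encodeℕ }

  encodable-× : {A B : Set} {{_ : Encodable A}} {{_ : Encodable B}} → Encodable (A × B)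
  encodable-× = record { ⌜_⌝ = λ (a , b) → node ⌜ a ⌝ ⌜ b ⌝ }

  encodable-List : {A : Set} {{_ : Encodable A}} → Encodable (List A)
  encodable-List = record { ⌜_⌝ = λ xs → encodeList (map ⌜_⌝ xs) }

record Feasible {A B : Set} {{_ : Encodable A}} {{_ : Encodable B}} (f : A → B) : Set where
  field
    prog  : Program
    cost  : Poly
    halts : ∀ a → prog ⊢ ⌜ a ⌝ ⇓ ⌜ f a ⌝ within ⟦ cost ⟧ ⟪ a ⟫

open Feasible

module _ {A B : Set} {{_ : Encodable A}} {{_ : Encodable B}} {f : A → B} where

  size-bound : (F : Feasible f) → ∀ a → ⟪ f a ⟫ ≤ ⟦ cost F ⟧ ⟪ a ⟫
  size-bound F a = let (_ , p , t≤) = halts F a in ≤-trans (output≤cost p) t≤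

  feasible-≗ : {g : A → B} → f ≗ g → Feasible f → Feasible g
  feasible-≗ f≗g F = record
    { prog  = prog F ; cost = cost F
    ; halts = λ a → subst (λ b → _ ⊢ _ ⇓ ⌜ b ⌝ within _) (f≗g a) (halts F a) }

-- Serves for functions that change the type of a value but not its tree, such as the passage
-- between numbers and lists of units.
copyᶠ : {A B : Set} {{_ : Encodable A}} {{_ : Encodable B}} {f : A → B} →
        (∀ a → ⌜ f a ⌝ ≡ ⌜ a ⌝) → Feasible f
copyᶠ f≈id = record
  { prog = copy ; cost = var
  ; halts = λ a → subst (λ y → copy ⊢ ⌜ a ⌝ ⇓ y within ⟪ a ⟫) (sym (f≈id a)) (_ , copy⇓ , ≤-refl) }

idᶠ : {A : Set} {{_ : Encodable A}} → Feasible {A} {A} (λ a → a)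
idᶠ = copyᶠ λ _ → refl

fstᶠ : {A B : Set} {{_ : Encodable A}} {{_ : Encodable B}} → Feasible {A × B} {A} proj₁
fstᶠ = record { prog = hd ; cost = var ; halts = λ _ → hd-within ≤-refl }

sndᶠ : {A B : Set} {{_ : Encodable A}} {{_ : Encodable B}} → Feasible {A × B} {B} proj₂
sndᶠ = record { prog = tl ; cost = var ; halts = λ _ → tl-within ≤-refl }

constantly : Tree → Program
constantly leaf       = nil
constantly (node l r) = cons (constantly l) (constantly r)

constantly-cost : Tree → Poly
constantly-cost leaf       = var
constantly-cost (node l r) = var ⊕ constantly-cost l ⊕ constantly-cost r

constantly-halts : ∀ y x → constantly y ⊢ x ⇓ y within ⟦ constantly-cost y ⟧ (size x)
constantly-halts leaf       x = _ , nil⇓ , ≤-refl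
constantly-halts (node l r) x = cons-within ≤-refl (constantly-halts l x) (constantly-halts r x)

module _ {Γ A : Set} {{_ : Encodable Γ}} {{_ : Encodable A}} where

  constᶠ : (a : A) → Feasible {Γ} (λ _ → a)
  constᶠ a = record { prog = constantly ⌜ a ⌝ ; cost = constantly-cost ⌜ a ⌝
                    ; halts = λ γ → constantly-halts ⌜ a ⌝ ⌜ γ ⌝ }

  infixr 9 _∘ᶠ_

  _∘ᶠ_ : {B : Set} {{_ : Encodable B}} {f : A → B} {g : Γ → A} → Feasible f → Feasible g → Feasible (λ γ → f (g γ))
  _∘ᶠ_ {g = g} F G = record
    { prog = prog F ⊚ prog G
    ; cost = var ⊕ cost G ⊕ cost F ⟨ cost G ⟩
    ; halts = λ γ → let (t , p , t≤) = halts F (g γ) in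
        ⊚-within ≤-refl (halts G γ)
          (t , p , ≤-trans t≤ (≤-trans (⟦⟧-mono (cost F) (size-bound G γ))
                                       (≤-reflexive (sym (⟦⟧-subst (cost F) (cost G) ⟪ γ ⟫))))) }

  infixr 4 _,ᶠ_

  _,ᶠ_ : {B : Set} {{_ : Encodable B}} {f : Γ → A} {g : Γ → B} → Feasible f → Feasible g → Feasible (λ γ → (f γ , g γ))
  F ,ᶠ G = record
    { prog = cons (prog F) (prog G) ; cost = var ⊕ cost F ⊕ cost G
    ; halts = λ γ → cons-within ≤-refl (halts F γ) (halts G γ) }

  -- `Poly` has no maximum, so the cost adds up both branches.
  ifᶠ : {b : Γ → Bool} {f g : Γ → A} → Feasible b → Feasible f → Feasible g →
        Feasible (λ γ → if b γ then f γ else g γ)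
  ifᶠ {b} {f} {g} B F G = record
    { prog = if (prog B) (prog F) (prog G)
    ; cost = var ⊕ cost B ⊕ (cost F ⊕ cost G)
    ; halts = λ γ → branch γ (b γ) (halts B γ) }
    where
    branch : ∀ γ c → prog B ⊢ ⌜ γ ⌝ ⇓ encodeBool c within ⟦ cost B ⟧ ⟪ γ ⟫ →
             if (prog B) (prog F) (prog G) ⊢ ⌜ γ ⌝ ⇓ ⌜ if c then f γ else g γ ⌝
               within ⟦ var ⊕ cost B ⊕ (cost F ⊕ cost G) ⟧ ⟪ γ ⟫
    branch γ true  (_ , r , s≤) = let (_ , p , t≤) = halts F γ in
      _ , if-then r p , +-mono-≤ (+-monoʳ-≤ ⟪ γ ⟫ s≤) (≤-trans t≤ (m≤m+n _ _))
    branch γ false (_ , r , s≤) = let (_ , p , t≤) = halts G γ in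
      _ , if-else r p , +-mono-≤ (+-monoʳ-≤ ⟪ γ ⟫ s≤) (≤-trans t≤ (m≤n+m _ _))

module _ {Γ A : Set} {{_ : Encodable Γ}} {{_ : Encodable A}} where

  []ᶠ : Feasible {Γ} {List A} (λ _ → [])
  []ᶠ = constᶠ []

  infixr 5 _∷ᶠ_

  _∷ᶠ_ : {f : Γ → A} {g : Γ → List A} → Feasible f → Feasible g → Feasible (λ γ → f γ ∷ g γ)
  F ∷ᶠ G = record { prog = prog P ; cost = cost P ; halts = halts P }
    where P = F ,ᶠ G

caseList : {A B : Set} → List A → B → (A → List A → B) → B
caseList []       z s = z
caseList (x ∷ xs) z s = s x xs

-- A nonempty list and the pair of its head and tail have the same encoding.
caseᶠ : {Γ A B : Set} {{_ : Encodable Γ}} {{_ : Encodable A}} {{_ : Encodable B}}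
        {xs : Γ → List A} {z : Γ → B} {s : Γ → A → List A → B} →
        Feasible xs → Feasible z →
        Feasible {Γ × (A × List A)} (λ (γ , a , as) → s γ a as) →
        Feasible (λ γ → caseList (xs γ) (z γ) (s γ))
caseᶠ {xs = xs} {z} {s} X Y S = record
  { prog = if (prog X) (prog S ⊚ cons copy (prog X)) (prog Y)
  ; cost = total
  ; halts = λ γ → branch γ (xs γ) (halts X γ) }
  where
  pairing step total : Poly
  pairing = var ⊕ var ⊕ cost X
  step = var ⊕ pairing ⊕ cost S ⟨ pairing ⟩
  total = var ⊕ cost X ⊕ (step ⊕ cost Y)
  branch : ∀ γ ys → prog X ⊢ ⌜ γ ⌝ ⇓ ⌜ ys ⌝ within ⟦ cost X ⟧ ⟪ γ ⟫ →
           if (prog X) (prog S ⊚ cons copy (prog X)) (prog Y) ⊢ ⌜ γ ⌝ ⇓ ⌜ caseList ys (z γ) (s γ) ⌝ within ⟦ total ⟧ ⟪ γ ⟫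
  branch γ [] (_ , r , s≤) = let (_ , p , t≤) = halts Y γ in
    _ , if-else r p , +-mono-≤ (+-monoʳ-≤ ⟪ γ ⟫ s≤) (≤-trans t≤ (m≤n+m _ (⟦ step ⟧ ⟪ γ ⟫)))
  branch γ (y ∷ ys) (_ , r , s≤) = _ , if-then r (proj₁ (proj₂ run)) ,
      +-mono-≤ (+-monoʳ-≤ ⟪ γ ⟫ s≤) (≤-trans (proj₂ (proj₂ run)) (m≤m+n _ _))
    where
    paired : cons copy (prog X) ⊢ ⌜ γ ⌝ ⇓ ⌜ γ , y , ys ⌝ within ⟦ pairing ⟧ ⟪ γ ⟫
    paired = cons-within ≤-refl (_ , copy⇓ , ≤-refl) (_ , r , s≤)
    run : prog S ⊚ cons copy (prog X) ⊢ ⌜ γ ⌝ ⇓ ⌜ s γ y ys ⌝ within ⟦ step ⟧ ⟪ γ ⟫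
    run = let (_ , p , t≤) = halts S (γ , y , ys)
              (_ , q , u≤) = paired in
      ⊚-within ≤-refl paired
        (_ , p , ≤-trans t≤ (≤-trans (⟦⟧-mono (cost S) (≤-trans (output≤cost q) u≤))
                                     (≤-reflexive (sym (⟦⟧-subst (cost S) pairing ⟪ γ ⟫)))))

-- Loops over lists

length≤size : {A : Set} {{_ : Encodable A}} (xs : List A) → length xs ≤ ⟪ xs ⟫
length≤size []       = z≤n
length≤size (x ∷ xs) = s≤s (m≤n⇒m≤o+n ⟪ x ⟫ (length≤size xs))

module _ {Γ A B : Set} {{_ : Encodable Γ}} {{_ : Encodable A}} {{_ : Encodable B}}
         {f : Γ → B → A → B}
         (F : Feasible {(Γ × A) × B} {B} (λ ((γ , a) , b) → f γ b a))
         -- Additive growth is what keeps the iterates of polynomial size.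
         (g : Poly) (growth : ∀ γ a b → ⟪ f γ b a ⟫ ≤ ⟪ b ⟫ + ⟦ g ⟧ ⟪ (γ , a) ⟫) where

  private
    -- The loop state is the tree of `(γ , (xs , b))`. Only the empty list is encoded as `leaf`, so
    -- the remaining list is itself the test.
    test body : Program
    test = hd ⊚ tl
    body = cons hd (cons (tl ⊚ hd ⊚ tl) (prog F ⊚ cons (cons hd (hd ⊚ hd ⊚ tl)) (tl ⊚ tl)))

    infixl 6 _⊞_
    _⊞_ : Poly → Poly → Poly
    P ⊞ Q = var ⊕ P ⊕ Q

    -- Follows the shape of `test` and `body`: one `var` for each construct evaluated, standing for
    -- a common bound on the loop states, and `cost F` for the call of `f`.
    round : Poly
    round = var ⊕ (var ⊞ var) ⊕
      (var ⊞ (((var ⊞ var) ⊞ var) ⊞ (((var ⊞ ((var ⊞ var) ⊞ var)) ⊞ (var ⊞ var)) ⊞ cost F)))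

    test-halts : ∀ {Z} (γ : Γ) (xs : List A) (b : B) → ⟪ (γ , (xs , b)) ⟫ ≤ Z → test ⊢ ⌜ (γ , (xs , b)) ⌝ ⇓ ⌜ xs ⌝ within Z + Z + Z
    test-halts γ xs b ≤Z = ⊚-within ≤Z (tl-within ≤Z) (hd-within (node≤⇒right≤ ⌜ γ ⌝ ⌜ (xs , b) ⌝ ≤Z))

    body-halts : ∀ {Z} (γ : Γ) (x : A) (xs : List A) (b : B) → ⟪ (γ , (x ∷ xs , b)) ⟫ ≤ Z →
      body ⊢ ⌜ (γ , (x ∷ xs , b)) ⌝ ⇓ ⌜ (γ , (xs , f γ b x)) ⌝ within
        ⟦ var ⊞ (((var ⊞ var) ⊞ var) ⊞ (((var ⊞ ((var ⊞ var) ⊞ var)) ⊞ (var ⊞ var)) ⊞ cost F)) ⟧ Z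
    body-halts {Z} γ x xs b ≤Z =
      cons-within ≤Z (hd-within ≤Z) (cons-within ≤Z
        (⊚-within ≤Z (⊚-within ≤Z (tl-within ≤Z) (hd-within ≤Z₁)) (tl-within ≤Z₂))
        (⊚-within ≤Z
          (cons-within ≤Z
            (cons-within ≤Z (hd-within ≤Z)
              (⊚-within ≤Z (⊚-within ≤Z (tl-within ≤Z) (hd-within ≤Z₁)) (hd-within ≤Z₂)))
            (⊚-within ≤Z (tl-within ≤Z) (tl-within ≤Z₁)))
          (let (_ , p , t≤) = halts F ((γ , x) , b) in _ , p , ≤-trans t≤ (⟦⟧-mono (cost F) ≤Z₃))))
      where
      ≤Z₁ : ⟪ (x ∷ xs , b) ⟫ ≤ Z
      ≤Z₁ = node≤⇒right≤ ⌜ γ ⌝ ⌜ (x ∷ xs , b) ⌝ ≤Z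
      ≤Z₂ : ⟪ x ∷ xs ⟫ ≤ Z
      ≤Z₂ = node≤⇒left≤ ⌜ x ∷ xs ⌝ ⌜ b ⌝ ≤Z₁
      open ≤-Reasoning
      -- The argument of `f` rearranges the loop state, leaving out the rest of the list and one
      -- node.
      ≤Z₃ : ⟪ ((γ , x) , b) ⟫ ≤ Z
      ≤Z₃ = begin
        1 + (1 + (⟪ γ ⟫ + ⟪ x ⟫) + ⟪ b ⟫)                    ≤⟨ m≤n+m _ (1 + ⟪ xs ⟫) ⟩
        1 + ⟪ xs ⟫ + (1 + (1 + (⟪ γ ⟫ + ⟪ x ⟫) + ⟪ b ⟫))     ≡⟨ solve 4 (λ c x b xs →
            con 1 :+ xs :+ (con 1 :+ (con 1 :+ (c :+ x) :+ b)) := con 1 :+ (c :+ (con 1 :+ (con 1 :+ (x :+ xs) :+ b))))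
            refl (⟪ γ ⟫) (⟪ x ⟫) (⟪ b ⟫) (⟪ xs ⟫) ⟩
        ⟪ (γ , (x ∷ xs , b)) ⟫                                ≤⟨ ≤Z ⟩
        Z                                                     ∎

    -- The potential `size of the state + remaining rounds * G` never increases, because a round
    -- enlarges the accumulator by at most `G`. Hence one `Z` bounds all states of the run. The
    -- bound by `G` is asked for every list not larger than `xs` so that it passes to the rest of
    -- the list.
    loop-halts : ∀ {Z} (γ : Γ) (xs : List A) (b : B) G →
      (∀ (xs′ : List A) → ⟪ xs′ ⟫ ≤ ⟪ xs ⟫ → ∀ (x : A) → ⟪ x ⟫ ≤ ⟪ xs′ ⟫ → ⟦ g ⟧ ⟪ (γ , x) ⟫ ≤ G) →
      ⟪ (γ , (xs , b)) ⟫ + length xs * G ≤ Z →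
      while test body ⊢ ⌜ (γ , (xs , b)) ⌝ ⇓ ⌜ (γ , ([] {A = A} , foldl (f γ) b xs)) ⌝ within suc (length xs) * ⟦ round ⟧ Z
    loop-halts {Z} γ [] b G ≤G ≤Z = let (_ , p , t≤) = test-halts γ [] b ≤Z′ in
      _ , while-stop p ,
      ≤-trans (+-mono-≤ ≤Z′ t≤) (≤-trans (m≤m+n _ _) (≤-reflexive (sym (+-identityʳ _))))
      where
      ≤Z′ : ⟪ (γ , ([] {A = A} , b)) ⟫ ≤ Z
      ≤Z′ = ≤-trans (m≤m+n _ _) ≤Z
    loop-halts {Z} γ (x ∷ xs) b G ≤G ≤Z =
      let (_ , p , s≤) = test-halts γ (x ∷ xs) b ≤Z′
          (_ , q , t≤) = body-halts γ x xs b ≤Z′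
          (_ , r , u≤) = loop-halts γ xs (f γ b x) G
                           (λ xs′ xs′≤ → ≤G xs′ (≤-trans xs′≤ xs≤)) ≤Z″
      in _ , while-step p q r , +-mono-≤ (+-mono-≤ (+-mono-≤ ≤Z′ s≤) t≤) u≤
      where
      xs≤ : ⟪ xs ⟫ ≤ ⟪ x ∷ xs ⟫
      xs≤ = node≤⇒right≤ ⌜ x ⌝ ⌜ xs ⌝ ≤-refl
      ≤Z′ : ⟪ (γ , (x ∷ xs , b)) ⟫ ≤ Z
      ≤Z′ = ≤-trans (m≤m+n _ _) ≤Z
      open ≤-Reasoning
      ≤Z″ : ⟪ (γ , (xs , f γ b x)) ⟫ + length xs * G ≤ Z
      ≤Z″ = begin
        1 + (⟪ γ ⟫ + (1 + (⟪ xs ⟫ + ⟪ f γ b x ⟫))) + length xs * G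
          ≤⟨ +-monoˡ-≤ _ (s≤s (+-monoʳ-≤ ⟪ γ ⟫ (s≤s (+-mono-≤ xs≤
               (≤-trans (growth γ x b) (+-monoʳ-≤ ⟪ b ⟫ (≤G (x ∷ xs) ≤-refl x (node≤⇒left≤ ⌜ x ⌝ ⌜ xs ⌝ ≤-refl)))))))) ⟩
        1 + (⟪ γ ⟫ + (1 + (⟪ x ∷ xs ⟫ + (⟪ b ⟫ + G)))) + length xs * G
          ≡⟨ solve 5 (λ c xs b g l → con 1 :+ (c :+ (con 1 :+ (xs :+ (b :+ g)))) :+ l :* g :=
                       con 1 :+ (c :+ (con 1 :+ (xs :+ b))) :+ (con 1 :+ l) :* g)
               refl (⟪ γ ⟫) (⟪ x ∷ xs ⟫) (⟪ b ⟫) G (length xs) ⟩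
        ⟪ (γ , (x ∷ xs , b)) ⟫ + length (x ∷ xs) * G   ≤⟨ ≤Z ⟩
        Z                                              ∎

    loopᶠ : Feasible {Γ × (List A × B)} {Γ × (List A × B)} (λ (γ , (xs , b)) → (γ , ([] , foldl (f γ) b xs)))
    loopᶠ = record
      { prog = while test body
      -- On inputs of size s there are at most s rounds and the final test, with states of size at
      -- most s + s * g(s).
      ; cost = (♯ 1 ⊕ var) ⊗ round ⟨ var ⊕ var ⊗ g ⟩
      ; halts = λ (γ , (xs , b)) →
          let s = ⟪ (γ , (xs , b)) ⟫
              xs≤s : ⟪ xs ⟫ ≤ s
              xs≤s = node≤⇒left≤ ⌜ xs ⌝ ⌜ b ⌝ (node≤⇒right≤ ⌜ γ ⌝ ⌜ (xs , b) ⌝ ≤-refl)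
              γx≤s : ∀ (xs′ : List A) → ⟪ xs′ ⟫ ≤ ⟪ xs ⟫ → ∀ (x : A) → ⟪ x ⟫ ≤ ⟪ xs′ ⟫ → ⟪ (γ , x) ⟫ ≤ s
              γx≤s xs′ xs′≤ x x≤ = s≤s (+-monoʳ-≤ ⟪ γ ⟫ (≤-trans x≤ (≤-trans xs′≤ (node≤⇒left≤ ⌜ xs ⌝ ⌜ b ⌝ ≤-refl))))
              (t , p , t≤) = loop-halts γ xs b (⟦ g ⟧ s)
                 (λ xs′ xs′≤ x x≤ → ⟦⟧-mono g (γx≤s xs′ xs′≤ x x≤))
                 (+-monoʳ-≤ s (*-monoˡ-≤ (⟦ g ⟧ s) (≤-trans (length≤size xs) xs≤s)))
          in t , p , ≤-trans t≤ (*-mono-≤ (s≤s (≤-trans (length≤size xs) xs≤s))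
                                          (≤-reflexive (sym (⟦⟧-subst round (var ⊕ var ⊗ g) s)))) }

  foldlᶠ : {z : Γ → B} {xs : Γ → List A} → Feasible z → Feasible xs → Feasible (λ γ → foldl (f γ) (z γ) (xs γ))
  foldlᶠ Z X = sndᶠ ∘ᶠ sndᶠ ∘ᶠ loopᶠ ∘ᶠ (idᶠ ,ᶠ X ,ᶠ Z)

-- List operations

headᶠ : {Γ A : Set} {{_ : Encodable Γ}} {{_ : Encodable A}} {xs : Γ → List A} (d : A) →
        Feasible xs → Feasible (λ γ → caseList (xs γ) d (λ x _ → x))
headᶠ d X = caseᶠ X (constᶠ d) (fstᶠ ∘ᶠ sndᶠ)

tail : {A : Set} → List A → List A
tail xs = caseList xs [] (λ _ ys → ys)

tailᶠ : {Γ A : Set} {{_ : Encodable Γ}} {{_ : Encodable A}} {xs : Γ → List A} →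
        Feasible xs → Feasible (λ γ → tail (xs γ))
tailᶠ X = caseᶠ X []ᶠ (sndᶠ ∘ᶠ sndᶠ)

size-tail : {A : Set} {{_ : Encodable A}} (xs : List A) → ⟪ tail xs ⟫ ≤ ⟪ xs ⟫
size-tail []       = ≤-refl
size-tail (x ∷ xs) = node≤⇒right≤ ⌜ x ⌝ ⌜ xs ⌝ ≤-refl

size-∷ : {A : Set} {{_ : Encodable A}} (x : A) (xs : List A) → ⟪ x ∷ xs ⟫ ≡ ⟪ xs ⟫ + suc ⟪ x ⟫
size-∷ x xs = trans (cong suc (+-comm ⟪ x ⟫ ⟪ xs ⟫)) (sym (+-suc ⟪ xs ⟫ ⟪ x ⟫))

reverseᶠ : {Γ A : Set} {{_ : Encodable Γ}} {{_ : Encodable A}} {xs : Γ → List A} →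
           Feasible xs → Feasible (λ γ → reverse (xs γ))
reverseᶠ {Γ} {A} X = foldlᶠ {f = λ (_ : Γ) (ys : List A) y → y ∷ ys}
  ((sndᶠ ∘ᶠ fstᶠ) ∷ᶠ sndᶠ) var
  (λ γ y ys → ≤-trans (≤-reflexive (size-∷ y ys)) (+-monoʳ-≤ ⟪ ys ⟫ (s≤s (m≤n+m ⟪ y ⟫ ⟪ γ ⟫))))
  []ᶠ X

module _ {Γ A B : Set} {{_ : Encodable Γ}} {{_ : Encodable A}} {{_ : Encodable B}} where

  -- The loop consumes its list from the left, so the list is reversed beforehand.
  foldrᶠ : {f : Γ → A → B → B} {z : Γ → B} {xs : Γ → List A} →
           Feasible {(Γ × A) × B} (λ ((γ , a) , b) → f γ a b) →
           (g : Poly) → (∀ γ a b → ⟪ f γ a b ⟫ ≤ ⟪ b ⟫ + ⟦ g ⟧ ⟪ (γ , a) ⟫) →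
           Feasible z → Feasible xs → Feasible (λ γ → foldr (f γ) (z γ) (xs γ))
  foldrᶠ {f} {z} {xs} F g growth Z X = feasible-≗
    (λ γ → trans (sym (reverse-foldr (f γ) (z γ) (reverse (xs γ))))
                 (cong (foldr (f γ) (z γ)) (reverse-involutive (xs γ))))
    (foldlᶠ {f = λ γ b a → f γ a b} F g growth Z (reverseᶠ X))

size-++ : {A : Set} {{_ : Encodable A}} (xs ys : List A) → ⟪ xs ++ ys ⟫ ≤ ⟪ xs ⟫ + ⟪ ys ⟫
size-++ []       ys = n≤1+n _
size-++ (x ∷ xs) ys = s≤s (≤-trans (+-monoʳ-≤ ⟪ x ⟫ (size-++ xs ys)) (≤-reflexive (sym (+-assoc ⟪ x ⟫ ⟪ xs ⟫ ⟪ ys ⟫))))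

size-filter : {A : Set} {{_ : Encodable A}} {P : A → Set} (P? : Decidable P) (xs : List A) → ⟪ filter P? xs ⟫ ≤ ⟪ xs ⟫
size-filter P? []       = ≤-refl
size-filter P? (x ∷ xs) with does (P? x)
... | true  = s≤s (+-monoʳ-≤ ⟪ x ⟫ (size-filter P? xs))
... | false = m≤n⇒m≤1+n (m≤n⇒m≤o+n ⟪ x ⟫ (size-filter P? xs))

size-Bool : (b : Bool) → ⟪ b ⟫ ≤ 3
size-Bool false = s≤s z≤n
size-Bool true  = ≤-refl

module _ {Γ : Set} {{_ : Encodable Γ}} where

  notᶠ : {b : Γ → Bool} → Feasible b → Feasible (λ γ → not (b γ))
  notᶠ {b} B = feasible-≗ (λ γ → lemma (b γ)) (ifᶠ B (constᶠ false) (constᶠ true))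
    where
    lemma : ∀ c → (if c then false else true) ≡ not c
    lemma true  = refl
    lemma false = refl

  infixr 6 _∧ᶠ_
  infixr 5 _∨ᶠ_

  _∧ᶠ_ : {b c : Γ → Bool} → Feasible b → Feasible c → Feasible (λ γ → b γ ∧ c γ)
  _∧ᶠ_ {b} {c} B C = feasible-≗ (λ γ → lemma (b γ) (c γ)) (ifᶠ B C (constᶠ false))
    where
    lemma : ∀ x y → (if x then y else false) ≡ x ∧ y
    lemma true  y = refl
    lemma false y = refl

  _∨ᶠ_ : {b c : Γ → Bool} → Feasible b → Feasible c → Feasible (λ γ → b γ ∨ c γ)
  _∨ᶠ_ {b} {c} B C = feasible-≗ (λ γ → lemma (b γ) (c γ)) (ifᶠ B (constᶠ true) C)
    where
    lemma : ∀ x y → (if x then true else y) ≡ x ∨ y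
    lemma true  y = refl
    lemma false y = refl

module _ {Γ A : Set} {{_ : Encodable Γ}} {{_ : Encodable A}} where

  infixr 5 _++ᶠ_

  _++ᶠ_ : {xs ys : Γ → List A} → Feasible xs → Feasible ys → Feasible (λ γ → xs γ ++ ys γ)
  _++ᶠ_ {xs} {ys} X Y = feasible-≗ (λ γ → sym (++-is-foldr (xs γ) (ys γ)))
    (foldrᶠ {f = λ _ → _∷_} ((sndᶠ ∘ᶠ fstᶠ) ∷ᶠ sndᶠ) var
      (λ γ y ys → ≤-trans (≤-reflexive (size-∷ y ys)) (+-monoʳ-≤ ⟪ ys ⟫ (s≤s (m≤n+m ⟪ y ⟫ ⟪ γ ⟫))))
      Y X)

  any?ᶠ : {P : Γ → A → Set} {P? : ∀ γ → Decidable (P γ)} {xs : Γ → List A} →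
          Feasible {Γ × A} (λ (γ , a) → does (P? γ a)) → Feasible xs →
          Feasible (λ γ → does (any? (P? γ) (xs γ)))
  any?ᶠ {P? = P?} {xs} P X = feasible-≗ (λ γ → lemma γ (xs γ))
    (foldrᶠ {f = λ γ a b → does (P? γ a) ∨ b} ((P ∘ᶠ fstᶠ) ∨ᶠ sndᶠ) (♯ 3)
      (λ γ a b → ≤-trans (size-Bool (does (P? γ a) ∨ b)) (m≤n+m 3 ⟪ b ⟫)) (constᶠ false) X)
    where
    lemma : ∀ γ ys → foldr (λ a b → does (P? γ a) ∨ b) false ys ≡ does (any? (P? γ) ys)
    lemma γ []       = refl
    lemma γ (y ∷ ys) = cong (does (P? γ y) ∨_) (lemma γ ys)

module _ {Γ A B : Set} {{_ : Encodable Γ}} {{_ : Encodable A}} {{_ : Encodable B}} where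

  concatMapᶠ : {f : Γ → A → List B} {xs : Γ → List A} →
               Feasible {Γ × A} (λ (γ , a) → f γ a) → Feasible xs → Feasible (λ γ → concatMap (f γ) (xs γ))
  concatMapᶠ {f} {xs} F X = feasible-≗ (λ γ → lemma γ (xs γ))
    (foldrᶠ {f = λ γ a bs → f γ a ++ bs} ((F ∘ᶠ fstᶠ) ++ᶠ sndᶠ) (cost F)
      (λ γ a bs → ≤-trans (size-++ (f γ a) bs)
                 (≤-trans (+-monoˡ-≤ ⟪ bs ⟫ (size-bound F (γ , a))) (≤-reflexive (+-comm _ ⟪ bs ⟫))))
      []ᶠ X)
    where
    lemma : ∀ γ ys → foldr (λ a bs → f γ a ++ bs) [] ys ≡ concatMap (f γ) ys
    lemma γ []       = refl
    lemma γ (y ∷ ys) = cong (f γ y ++_) (lemma γ ys)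

module _ {Γ A B : Set} {{_ : Encodable Γ}} {{_ : Encodable A}} {{_ : Encodable B}} where

  mapᶠ : {f : Γ → A → B} {xs : Γ → List A} →
         Feasible {Γ × A} (λ (γ , a) → f γ a) → Feasible xs → Feasible (λ γ → map (f γ) (xs γ))
  mapᶠ {f} {xs} F X = feasible-≗ (λ γ → lemma γ (xs γ)) (concatMapᶠ {f = λ γ a → f γ a ∷ []} (F ∷ᶠ []ᶠ) X)
    where
    lemma : ∀ γ ys → concatMap (λ a → f γ a ∷ []) ys ≡ map (f γ) ys
    lemma γ []       = refl
    lemma γ (y ∷ ys) = cong (f γ y ∷_) (lemma γ ys)

module _ {Γ A B : Set} {{_ : Encodable Γ}} {{_ : Encodable A}} {{_ : Encodable B}} where

  cartesianProductᶠ : {xs : Γ → List A} {ys : Γ → List B} →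
                      Feasible xs → Feasible ys → Feasible (λ γ → cartesianProduct (xs γ) (ys γ))
  cartesianProductᶠ {xs} {ys} X Y = feasible-≗ (λ γ → lemma (ys γ) (xs γ))
    (concatMapᶠ {f = λ γ a → map (a ,_) (ys γ)}
      (mapᶠ {f = λ (_ , a) b → a , b} ((sndᶠ ∘ᶠ fstᶠ) ,ᶠ sndᶠ) (Y ∘ᶠ fstᶠ)) X)
    where
    lemma : ∀ vs us → concatMap (λ a → map (a ,_) vs) us ≡ cartesianProduct us vs
    lemma vs []       = refl
    lemma vs (u ∷ us) = cong (map (u ,_) vs ++_) (lemma vs us)

module _ {Γ A : Set} {{_ : Encodable Γ}} {{_ : Encodable A}} where

  filterᶠ : {P : Γ → A → Set} {P? : ∀ γ → Decidable (P γ)} {xs : Γ → List A} →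
            Feasible {Γ × A} (λ (γ , a) → does (P? γ a)) → Feasible xs →
            Feasible (λ γ → filter (P? γ) (xs γ))
  filterᶠ {P? = P?} {xs} P X = feasible-≗ (λ γ → lemma γ (xs γ))
    (concatMapᶠ {f = λ γ a → if does (P? γ a) then a ∷ [] else []} (ifᶠ P (sndᶠ ∷ᶠ []ᶠ) []ᶠ) X)
    where
    lemma : ∀ γ ys → concatMap (λ a → if does (P? γ a) then a ∷ [] else []) ys ≡ filter (P? γ) ys
    lemma γ []       = refl
    lemma γ (y ∷ ys) with does (P? γ y)
    ... | true  = cong (y ∷_) (lemma γ ys)
    ... | false = lemma γ ys

  -- Replacing all elements by units leaves a tree that already is the unary encoding of the length.
  lengthᶠ : {xs : Γ → List A} → Feasible xs → Feasible (λ γ → length (xs γ))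
  lengthᶠ {xs} X = feasible-≗ (λ γ → length-replicate (xs γ))
    (copyᶠ {f = length} ⌜length⌝ ∘ᶠ mapᶠ {f = λ _ _ → tt} (constᶠ tt) X)
    where
    ⌜length⌝ : ∀ (us : List ⊤) → ⌜ length us ⌝ ≡ ⌜ us ⌝
    ⌜length⌝ []       = refl
    ⌜length⌝ (_ ∷ us) = cong (node leaf) (⌜length⌝ us)
    length-replicate : ∀ (ys : List A) → length (map (λ _ → tt) ys) ≡ length ys
    length-replicate []       = refl
    length-replicate (_ ∷ ys) = cong suc (length-replicate ys)

-- Unary arithmetic

ticks : ℕ → List ⊤
ticks n = replicate n tt

-- Lets the folds over lists serve as recursion on numbers.
⌜ticks⌝ : ∀ n → ⌜ ticks n ⌝ ≡ ⌜ n ⌝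
⌜ticks⌝ zero    = refl
⌜ticks⌝ (suc n) = cong (node leaf) (⌜ticks⌝ n)

size-+ : ∀ m n → ⟪ m + n ⟫ ≤ ⟪ n ⟫ + ⟪ m ⟫
size-+ zero    n = m≤m+n ⟪ n ⟫ 1
size-+ (suc m) n = ≤-trans (s≤s (s≤s (size-+ m n)))
  (≤-reflexive (sym (trans (+-suc ⟪ n ⟫ (suc ⟪ m ⟫)) (cong suc (+-suc ⟪ n ⟫ ⟪ m ⟫)))))

size-pred : ∀ n → ⟪ pred n ⟫ ≤ ⟪ n ⟫
size-pred zero    = ≤-refl
size-pred (suc n) = m≤n⇒m≤o+n 2 ≤-refl

size-∸ : ∀ m n → ⟪ m ∸ n ⟫ ≤ ⟪ m ⟫
size-∸ m       zero    = ≤-refl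
size-∸ zero    (suc n) = ≤-refl
size-∸ (suc m) (suc n) = m≤n⇒m≤o+n 2 (size-∸ m n)

module _ {Γ : Set} {{_ : Encodable Γ}} where

  ticksᶠ : {n : Γ → ℕ} → Feasible n → Feasible (λ γ → ticks (n γ))
  ticksᶠ N = copyᶠ {f = ticks} ⌜ticks⌝ ∘ᶠ N

  sucᶠ : {n : Γ → ℕ} → Feasible n → Feasible (λ γ → suc (n γ))
  sucᶠ N = copyᶠ {f = λ (_ , n) → suc n} (λ _ → refl) ∘ᶠ (constᶠ tt ,ᶠ N)

  isZeroᶠ : {n : Γ → ℕ} → Feasible n → Feasible (λ γ → n γ ≡ᵇ 0)
  isZeroᶠ {n} N = feasible-≗ (λ γ → lemma (n γ)) (caseᶠ {s = λ _ _ _ → false} (ticksᶠ N) (constᶠ true) (constᶠ false))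
    where
    lemma : ∀ m → caseList (ticks m) true (λ _ _ → false) ≡ (m ≡ᵇ 0)
    lemma zero    = refl
    lemma (suc m) = refl

  predᶠ : {n : Γ → ℕ} → Feasible n → Feasible (λ γ → pred (n γ))
  predᶠ {n} N = feasible-≗ (λ γ → lemma (n γ)) (lengthᶠ (tailᶠ (ticksᶠ N)))
    where
    length-ticks : ∀ m → length (ticks m) ≡ m
    length-ticks zero    = refl
    length-ticks (suc m) = cong suc (length-ticks m)
    lemma : ∀ m → length (tail (ticks m)) ≡ pred m
    lemma zero    = refl
    lemma (suc m) = length-ticks m

module _ {Γ : Set} {{_ : Encodable Γ}} where

  infixl 6 _∸ᶠ_ _+ᶠ_

  _+ᶠ_ : {m n : Γ → ℕ} → Feasible m → Feasible n → Feasible (λ γ → m γ + n γ)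
  _+ᶠ_ {m} {n} M N = feasible-≗ (λ γ → lemma (m γ) (n γ))
    (foldrᶠ {f = λ _ _ → suc} (sucᶠ sndᶠ) (♯ 2) (λ _ _ k → ≤-reflexive (+-comm 2 ⟪ k ⟫)) N (ticksᶠ M))
    where
    lemma : ∀ x y → foldr (λ _ → suc) y (ticks x) ≡ x + y
    lemma zero    y = refl
    lemma (suc x) y = cong suc (lemma x y)

  _∸ᶠ_ : {m n : Γ → ℕ} → Feasible m → Feasible n → Feasible (λ γ → m γ ∸ n γ)
  _∸ᶠ_ {m} {n} M N = feasible-≗ (λ γ → lemma (m γ) (n γ))
    (foldlᶠ {f = λ _ k _ → pred k} (predᶠ sndᶠ) (♯ 0)
      (λ _ _ k → ≤-trans (size-pred k) (m≤m+n ⟪ k ⟫ 0)) M (ticksᶠ N))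
    where
    lemma : ∀ x y → foldl (λ k _ → pred k) x (ticks y) ≡ x ∸ y
    lemma x       zero    = refl
    lemma zero    (suc y) = trans (lemma zero y) (0∸n≡0 y)
    lemma (suc x) (suc y) = lemma x y

module _ {Γ : Set} {{_ : Encodable Γ}} where

  infixl 7 _*ᶠ_
  infix  4 _≤?ᶠ_ _<?ᶠ_ _≟ᶠ_

  _*ᶠ_ : {m n : Γ → ℕ} → Feasible m → Feasible n → Feasible (λ γ → m γ * n γ)
  _*ᶠ_ {m} {n} M N = feasible-≗ (λ γ → lemma (m γ) (n γ))
    (foldrᶠ {f = λ γ _ k → n γ + k} ((N ∘ᶠ fstᶠ ∘ᶠ fstᶠ) +ᶠ sndᶠ) (cost N)
      (λ γ _ k → ≤-trans (size-+ (n γ) k) (+-monoʳ-≤ ⟪ k ⟫ (≤-trans (size-bound N γ)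
                   (⟦⟧-mono (cost N) (node≤⇒left≤ ⌜ γ ⌝ leaf ≤-refl)))))
      (constᶠ 0) (ticksᶠ M))
    where
    lemma : ∀ x y → foldr (λ _ k → y + k) 0 (ticks x) ≡ x * y
    lemma zero    y = refl
    lemma (suc x) y = cong (y +_) (lemma x y)

  _≤?ᶠ_ : {m n : Γ → ℕ} → Feasible m → Feasible n → Feasible (λ γ → does (m γ ≤? n γ))
  _≤?ᶠ_ {m} {n} M N = feasible-≗ (λ γ → ∸≡ᵇ0 (m γ) (n γ)) (isZeroᶠ (M ∸ᶠ N))
    where
    ∸≡ᵇ0 : ∀ x y → (x ∸ y ≡ᵇ 0) ≡ does (x ≤? y)
    ∸≡ᵇ0 zero    zero    = refl
    ∸≡ᵇ0 zero    (suc y) = refl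
    ∸≡ᵇ0 (suc x) zero    = refl
    ∸≡ᵇ0 (suc x) (suc y) = trans (∸≡ᵇ0 x y) (≤ᵇ-suc x y)
      where
      ≤ᵇ-suc : ∀ x y → (x ≤ᵇ y) ≡ (x <ᵇ suc y)
      ≤ᵇ-suc zero    y = refl
      ≤ᵇ-suc (suc x) y = refl

  _<?ᶠ_ : {m n : Γ → ℕ} → Feasible m → Feasible n → Feasible (λ γ → does (m γ <? n γ))
  M <?ᶠ N = sucᶠ M ≤?ᶠ N

  _≟ᶠ_ : {m n : Γ → ℕ} → Feasible m → Feasible n → Feasible (λ γ → does (m γ ≟ n γ))
  _≟ᶠ_ {m} {n} M N = feasible-≗ (λ γ → lemma (m γ) (n γ)) ((M ≤?ᶠ N) ∧ᶠ (N ≤?ᶠ M))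
    where
    lemma : ∀ x y → does (x ≤? y) ∧ does (y ≤? x) ≡ does (x ≟ y)
    lemma zero    zero    = refl
    lemma zero    (suc y) = refl
    lemma (suc x) zero    = refl
    lemma (suc x) (suc y) = trans (cong₂ _∧_ (<ᵇ-suc x y) (<ᵇ-suc y x)) (lemma x y)
      where
      <ᵇ-suc : ∀ x y → (x <ᵇ suc y) ≡ (x ≤ᵇ y)
      <ᵇ-suc zero    y = refl
      <ᵇ-suc (suc x) y = refl

module _ {Γ : Set} {{_ : Encodable Γ}} where

  infix 4 _∈?ᶠ_

  _∈?ᶠ_ : {m : Γ → ℕ} {ns : Γ → List ℕ} → Feasible m → Feasible ns → Feasible (λ γ → does (m γ ∈? ns γ))
  _∈?ᶠ_ {m} M NS = any?ᶠ {P? = λ γ n → m γ ≟ n} ((M ∘ᶠ fstᶠ) ≟ᶠ sndᶠ) NS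

  -- The values n ∸ (n ∸ m) = m keep the new element bounded in terms of n alone.
  downFromᶠ : {n : Γ → ℕ} → Feasible n → Feasible (λ γ → downFrom (n γ))
  downFromᶠ {n} N = feasible-≗ (λ γ → lemma (n γ) (n γ) ≤-refl)
    (foldrᶠ {f = λ γ _ ms → (n γ ∸ (n γ ∸ length ms)) ∷ ms}
      ((N′ ∸ᶠ (N′ ∸ᶠ lengthᶠ sndᶠ)) ∷ᶠ sndᶠ) (♯ 1 ⊕ cost N)
      (λ γ _ ms → ≤-trans (≤-reflexive (size-∷ (n γ ∸ (n γ ∸ length ms)) ms))
         (+-monoʳ-≤ ⟪ ms ⟫ (s≤s (≤-trans (size-∸ (n γ) (n γ ∸ length ms))
           (≤-trans (size-bound N γ) (⟦⟧-mono (cost N) (node≤⇒left≤ ⌜ γ ⌝ leaf ≤-refl)))))))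
      []ᶠ (ticksᶠ N))
    where
    N′ : Feasible {(Γ × ⊤) × List ℕ} (λ p → n (proj₁ (proj₁ p)))
    N′ = N ∘ᶠ fstᶠ ∘ᶠ fstᶠ
    lemma : ∀ k m → m ≤ k → foldr (λ _ ms → (k ∸ (k ∸ length ms)) ∷ ms) [] (ticks m) ≡ downFrom m
    lemma k zero    _   = refl
    lemma k (suc m) m<k rewrite lemma k m (<⇒≤ m<k) =
      cong (_∷ downFrom m) (trans (cong (λ l → k ∸ (k ∸ l)) (length-downFrom m)) (m∸[m∸n]≡n (<⇒≤ m<k)))

  dropᶠ : {A : Set} {{_ : Encodable A}} {n : Γ → ℕ} {xs : Γ → List A} →
          Feasible n → Feasible xs → Feasible (λ γ → drop (n γ) (xs γ))
  dropᶠ {A} {n} {xs} N X = feasible-≗ (λ γ → lemma (n γ) (xs γ))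
    (foldlᶠ {f = λ _ ys _ → tail ys} (tailᶠ sndᶠ) (♯ 0)
      (λ _ _ ys → ≤-trans (size-tail ys) (m≤m+n ⟪ ys ⟫ 0)) X (ticksᶠ N))
    where
    lemma : ∀ m (ys : List A) → foldl (λ ys _ → tail ys) ys (ticks m) ≡ drop m ys
    lemma zero    ys       = refl
    lemma (suc m) []       = trans (lemma m []) (drop-[] m)
    lemma (suc m) (y ∷ ys) = lemma m ys

-- The kernelization algorithm

Matrix : Set
Matrix = List (List Bool)

-- Indices outside the matrix read `false`, which extends adjacency to all numbers: those that are
-- not vertices are isolated.
entry : Matrix → ℕ → ℕ → Bool
entry A u v = caseList (drop v (caseList (drop u A) [] (λ row _ → row))) false (λ b _ → b)

endpoints : List (ℕ × ℕ) → List ℕ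
endpoints = concatMap λ (u , v) → u ∷ v ∷ []

-- A state of the auction is its history of bids (item , bidder), latest first.
-- Prices are numbers of bids; as a new bid only adds to the history, the
-- states of the loop visibly stay of polynomial size.

price : List (ℕ × ℕ) → ℕ → ℕ
price J v = length (filter (λ b → v ≟ proj₁ b) J)

-- The current allocation: a bid displaces the earlier buyer of the same item, who is thereby
-- unserved again.
sold : List (ℕ × ℕ) → List (ℕ × ℕ)
sold = foldr (λ b X → b ∷ filter (λ c → ¬? (proj₁ c ≟ proj₁ b)) X) []

unserved : List ℕ → List (ℕ × ℕ) → List ℕ
unserved bidders J = filter (λ u → ¬? (u ∈? map proj₂ (sold J))) bidders

cheapest : List (ℕ × ℕ) → ℕ → List ℕ → ℕ
cheapest J = foldr (λ w v → if does (price J w ≤? price J v) then w else v)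

-- The candidates are the prices from `limit` down to 1; the default 0 is never returned when there
-- are fewer items than `limit`.
gap : ℕ → List ℕ → List (ℕ × ℕ) → ℕ
gap limit items J =
  caseList (filter (λ j → ¬? (any? (λ v → price J v ≟ j) items)) (map suc (downFrom limit))) 0 (λ j _ → j)

-- For the unattained price `j` this is the head of the crown together with its matching into the
-- buyers.
above : ℕ → List (ℕ × ℕ) → List (ℕ × ℕ)
above j J = filter (λ b → j <? price J (proj₁ b)) (sold J)

unmatched : List ℕ → List (ℕ × ℕ) → List ℕ
unmatched vs M = filter (λ w → ¬? (w ∈? endpoints M)) vs

-- `u` is the unserved vertex. Deleting it makes the vertex list shorter even when `X` is empty, as
-- for an isolated `u`.
removeCrown : List ℕ → ℕ → ℕ → List (ℕ × ℕ) → List ℕ × ℕ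
removeCrown vs k u X = filter (λ w → ¬? (w ∈? u ∷ endpoints X)) vs , k ∸ length X

module Search (A : Matrix) where

  infix 4 _~_ _~?_

  _~_ : ℕ → ℕ → Set
  u ~ v = T (entry A u v)

  _~?_ : ∀ u v → Dec (u ~ v)
  u ~? v = T? (entry A u v)

  extend : ℕ × ℕ → List (ℕ × ℕ) → List (ℕ × ℕ)
  extend (u , v) M =
    if does (u ~? v ×-dec (¬? (u ∈? endpoints M) ×-dec ¬? (v ∈? endpoints M))) then (u , v) ∷ M else M

  greedyMatching : List ℕ → List (ℕ × ℕ)
  greedyMatching vs = foldr extend [] (cartesianProduct vs vs)

  affordable : ℕ → List ℕ → List (ℕ × ℕ) → ℕ → List ℕ
  affordable limit items J u = filter (λ v → (u ~? v) ×-dec (price J v <? limit)) items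

  -- Only the first unserved bidder may act. If he can afford nothing, the history stays the same
  -- from then on, and he is the unserved vertex of the crown.
  bid : ℕ → List ℕ → List ℕ → List (ℕ × ℕ) → List (ℕ × ℕ)
  bid limit items bidders J =
    caseList (unserved bidders J) J λ u _ →
    caseList (affordable limit items J u) J λ v vs →
    (cheapest J v vs , u) ∷ J

  auction : ℕ → List ℕ → List ℕ → List (ℕ × ℕ) → List (ℕ × ℕ)
  auction limit items bidders = foldr (λ _ → bid limit items bidders) []

  bids : List ℕ → List (ℕ × ℕ) → List (ℕ × ℕ)
  -- The product is mere fuel, a list of n * n elements.
  bids vs M = auction (length vs) (endpoints M) (unmatched vs M) (cartesianProduct vs vs)

  reduceBy : List ℕ → ℕ → List (ℕ × ℕ) → List ℕ × ℕ
  reduceBy vs k M =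
    -- If everyone is served the instance is positive, and `([] , 0)` is a positive instance.
    caseList (unserved (unmatched vs M) (bids vs M)) ([] , 0) λ u _ →
    removeCrown vs k u (above (gap (length vs) (endpoints M) (bids vs M)) (bids vs M))

  opaque
    reduceLarge : List ℕ × ℕ → List (ℕ × ℕ) → List ℕ × ℕ
    reduceLarge s M = if does (proj₂ s ≤? length M) then [] , 0 else reduceBy (proj₁ s) (proj₂ s) M

  reduce : List ℕ × ℕ → List ℕ × ℕ
  reduce s =
    if does (length (proj₁ s) ≤? 3 * proj₂ s ∸ 3) then s else reduceLarge s (greedyMatching (proj₁ s))

  kernelize : ℕ → ℕ → List ℕ × ℕ
  -- The first `downFrom n` is the vertex set, the second one the fuel: a state that is still too
  -- large loses a vertex in every round.
  kernelize n k = foldr (λ _ → reduce) (downFrom n , k) (downFrom n)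

-- Polynomial cost of the algorithm

module _ where

  open Search

  entryᶠ : {Γ : Set} {{_ : Encodable Γ}} {A : Γ → Matrix} {u v : Γ → ℕ} →
           Feasible A → Feasible u → Feasible v → Feasible (λ γ → entry (A γ) (u γ) (v γ))
  entryᶠ A U V = headᶠ false (dropᶠ V (headᶠ [] (dropᶠ U A)))

  endpointsᶠ : {Γ : Set} {{_ : Encodable Γ}} {M : Γ → List (ℕ × ℕ)} → Feasible M → Feasible (λ γ → endpoints (M γ))
  endpointsᶠ M = concatMapᶠ ((fstᶠ ∘ᶠ sndᶠ) ∷ᶠ (sndᶠ ∘ᶠ sndᶠ) ∷ᶠ []ᶠ) M

  priceᶠ : {Γ : Set} {{_ : Encodable Γ}} {J : Γ → List (ℕ × ℕ)} {v : Γ → ℕ} →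
           Feasible J → Feasible v → Feasible (λ γ → price (J γ) (v γ))
  priceᶠ {v = v} J V = lengthᶠ (filterᶠ {P? = λ γ b → v γ ≟ proj₁ b} ((V ∘ᶠ fstᶠ) ≟ᶠ (fstᶠ ∘ᶠ sndᶠ)) J)

  soldᶠ : {Γ : Set} {{_ : Encodable Γ}} {J : Γ → List (ℕ × ℕ)} → Feasible J → Feasible (λ γ → sold (J γ))
  soldᶠ {Γ} J = foldrᶠ {f = λ _ b X → b ∷ filter (λ c → ¬? (proj₁ c ≟ proj₁ b)) X}
    ((sndᶠ ∘ᶠ fstᶠ) ∷ᶠ filterᶠ {Γ = (Γ × (ℕ × ℕ)) × List (ℕ × ℕ)} {P? = λ ((_ , b) , _) c → ¬? (proj₁ c ≟ proj₁ b)}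
      (notᶠ ((fstᶠ ∘ᶠ sndᶠ) ≟ᶠ (fstᶠ ∘ᶠ sndᶠ ∘ᶠ fstᶠ ∘ᶠ fstᶠ))) sndᶠ)
    var
    (λ γ b X → ≤-trans (≤-reflexive (size-∷ b (filter (λ c → ¬? (proj₁ c ≟ proj₁ b)) X)))
      (+-mono-≤ (size-filter (λ c → ¬? (proj₁ c ≟ proj₁ b)) X) (s≤s (m≤n+m ⟪ b ⟫ ⟪ γ ⟫))))
    []ᶠ J

  unservedᶠ : {Γ : Set} {{_ : Encodable Γ}} {I : Γ → List ℕ} {J : Γ → List (ℕ × ℕ)} →
              Feasible I → Feasible J → Feasible (λ γ → unserved (I γ) (J γ))
  unservedᶠ {J = J} I JF = filterᶠ {P? = λ γ u → ¬? (u ∈? map proj₂ (sold (J γ)))}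
    (notᶠ (sndᶠ ∈?ᶠ mapᶠ {f = λ _ b → proj₂ b} (sndᶠ ∘ᶠ sndᶠ) (soldᶠ JF ∘ᶠ fstᶠ))) I

  cheapestᶠ : {Γ : Set} {{_ : Encodable Γ}} {J : Γ → List (ℕ × ℕ)} {v : Γ → ℕ} {vs : Γ → List ℕ} →
              Feasible J → Feasible v → Feasible vs → Feasible (λ γ → cheapest (J γ) (v γ) (vs γ))
  cheapestᶠ {J = J} JF V VS = foldrᶠ {f = λ γ w v → if does (price (J γ) w ≤? price (J γ) v) then w else v}
    (ifᶠ (priceᶠ (JF ∘ᶠ fstᶠ ∘ᶠ fstᶠ) (sndᶠ ∘ᶠ fstᶠ) ≤?ᶠ priceᶠ (JF ∘ᶠ fstᶠ ∘ᶠ fstᶠ) sndᶠ) (sndᶠ ∘ᶠ fstᶠ) sndᶠ)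
    var growth V VS
    where
    growth : ∀ γ w v → ⟪ if does (price (J γ) w ≤? price (J γ) v) then w else v ⟫ ≤ ⟪ v ⟫ + ⟪ (γ , w) ⟫
    growth γ w v with does (price (J γ) w ≤? price (J γ) v)
    ... | true  = ≤-trans (node≤⇒right≤ ⌜ γ ⌝ ⌜ w ⌝ ≤-refl) (m≤n+m ⟪ (γ , w) ⟫ ⟪ v ⟫)
    ... | false = m≤m+n ⟪ v ⟫ ⟪ (γ , w) ⟫

  gapᶠ : {Γ : Set} {{_ : Encodable Γ}} {l : Γ → ℕ} {items : Γ → List ℕ} {J : Γ → List (ℕ × ℕ)} →
         Feasible l → Feasible items → Feasible J → Feasible (λ γ → gap (l γ) (items γ) (J γ))
  gapᶠ {items = items} {J} L S JF = headᶠ 0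
    (filterᶠ {P? = λ γ j → ¬? (any? (λ v → price (J γ) v ≟ j) (items γ))}
      (notᶠ (any?ᶠ {P? = λ (γ , j) v → price (J γ) v ≟ j}
        (priceᶠ (JF ∘ᶠ fstᶠ ∘ᶠ fstᶠ) sndᶠ ≟ᶠ (sndᶠ ∘ᶠ fstᶠ)) (S ∘ᶠ fstᶠ)))
      (mapᶠ {f = λ _ n → suc n} (sucᶠ sndᶠ) (downFromᶠ L)))

  aboveᶠ : {Γ : Set} {{_ : Encodable Γ}} {j : Γ → ℕ} {J : Γ → List (ℕ × ℕ)} →
           Feasible j → Feasible J → Feasible (λ γ → above (j γ) (J γ))
  aboveᶠ {j = j} {J} jF JF = filterᶠ {P? = λ γ b → j γ <? price (J γ) (proj₁ b)}
    ((jF ∘ᶠ fstᶠ) <?ᶠ priceᶠ (JF ∘ᶠ fstᶠ) (fstᶠ ∘ᶠ sndᶠ)) (soldᶠ JF)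

  greedyMatchingᶠ : {Γ : Set} {{_ : Encodable Γ}} {A : Γ → Matrix} {vs : Γ → List ℕ} →
                    Feasible A → Feasible vs → Feasible (λ γ → greedyMatching (A γ) (vs γ))
  greedyMatchingᶠ {Γ} {A} AF VS = foldrᶠ {f = λ γ → extend (A γ)}
    (ifᶠ (entryᶠ (AF ∘ᶠ fstᶠ ∘ᶠ fstᶠ) u v ∧ᶠ (notᶠ (u ∈?ᶠ endpointsᶠ sndᶠ) ∧ᶠ notᶠ (v ∈?ᶠ endpointsᶠ sndᶠ)))
         ((sndᶠ ∘ᶠ fstᶠ) ∷ᶠ sndᶠ) sndᶠ)
    var growth []ᶠ (cartesianProductᶠ VS VS)
    where
    u : Feasible {(Γ × (ℕ × ℕ)) × List (ℕ × ℕ)} (λ p → proj₁ (proj₂ (proj₁ p)))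
    u = fstᶠ ∘ᶠ sndᶠ ∘ᶠ fstᶠ
    v : Feasible {(Γ × (ℕ × ℕ)) × List (ℕ × ℕ)} (λ p → proj₂ (proj₂ (proj₁ p)))
    v = sndᶠ ∘ᶠ sndᶠ ∘ᶠ fstᶠ
    growth : ∀ γ e M → ⟪ extend (A γ) e M ⟫ ≤ ⟪ M ⟫ + ⟪ (γ , e) ⟫
    growth γ (u , v) M
      with does (_~?_ (A γ) u v ×-dec (¬? (u ∈? endpoints M) ×-dec ¬? (v ∈? endpoints M)))
    ... | true  = ≤-trans (≤-reflexive (size-∷ (u , v) M)) (+-monoʳ-≤ ⟪ M ⟫ (s≤s (m≤n+m ⟪ (u , v) ⟫ ⟪ γ ⟫)))
    ... | false = m≤m+n ⟪ M ⟫ ⟪ (γ , (u , v)) ⟫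

  affordableᶠ : {Γ : Set} {{_ : Encodable Γ}} {A : Γ → Matrix} {l : Γ → ℕ} {items : Γ → List ℕ}
                {J : Γ → List (ℕ × ℕ)} {u : Γ → ℕ} →
                Feasible A → Feasible l → Feasible items → Feasible J → Feasible u →
                Feasible (λ γ → affordable (A γ) (l γ) (items γ) (J γ) (u γ))
  affordableᶠ {A = A} {l} {J = J} {u} AF L S JF U =
    filterᶠ {P? = λ γ v → (_~?_ (A γ) (u γ) v) ×-dec (price (J γ) v <? l γ)}
      (entryᶠ (AF ∘ᶠ fstᶠ) (U ∘ᶠ fstᶠ) sndᶠ ∧ᶠ (priceᶠ (JF ∘ᶠ fstᶠ) sndᶠ <?ᶠ (L ∘ᶠ fstᶠ))) S

  bidᶠ : {Γ : Set} {{_ : Encodable Γ}} {A : Γ → Matrix} {l : Γ → ℕ} {items I : Γ → List ℕ} {J : Γ → List (ℕ × ℕ)} →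
         Feasible A → Feasible l → Feasible items → Feasible I → Feasible J →
         Feasible (λ γ → bid (A γ) (l γ) (items γ) (I γ) (J γ))
  bidᶠ AF L S IF JF = caseᶠ (unservedᶠ IF JF) JF
    (caseᶠ (affordableᶠ (AF ∘ᶠ fstᶠ) (L ∘ᶠ fstᶠ) (S ∘ᶠ fstᶠ) (JF ∘ᶠ fstᶠ) (fstᶠ ∘ᶠ sndᶠ)) (JF ∘ᶠ fstᶠ)
      ((cheapestᶠ (JF ∘ᶠ fstᶠ ∘ᶠ fstᶠ) (fstᶠ ∘ᶠ sndᶠ) (sndᶠ ∘ᶠ sndᶠ) ,ᶠ (fstᶠ ∘ᶠ sndᶠ ∘ᶠ fstᶠ)) ∷ᶠ (JF ∘ᶠ fstᶠ ∘ᶠ fstᶠ)))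

  size-cheapest : ∀ J v vs → ⟪ cheapest J v vs ⟫ ≤ ⟪ v ∷ vs ⟫
  size-cheapest J v []       = node≤⇒left≤ ⌜ v ⌝ leaf ≤-refl
  size-cheapest J v (w ∷ vs) with does (price J w ≤? price J (cheapest J v vs))
  ... | true  = node≤⇒left≤ ⌜ w ⌝ ⌜ vs ⌝ (node≤⇒right≤ ⌜ v ⌝ ⌜ w ∷ vs ⌝ ≤-refl)
  ... | false = ≤-trans (size-cheapest J v vs) (s≤s (+-monoʳ-≤ ⟪ v ⟫ (node≤⇒right≤ ⌜ w ⌝ ⌜ vs ⌝ ≤-refl)))

  -- Item and bidder are elements of the fixed lists `items` and `I`, so the growth does not depend
  -- on the history, as the loop demands.
  size-bid : ∀ A l items I J → ⟪ bid A l items I J ⟫ ≤ ⟪ J ⟫ + (2 + (⟪ items ⟫ + ⟪ I ⟫))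
  size-bid A l items I J with unserved I J in I-eq
  ... | [] = m≤m+n ⟪ J ⟫ _
  ... | u ∷ us with affordable A l items J u in S-eq
  ... | [] = m≤m+n ⟪ J ⟫ _
  ... | v ∷ vs = ≤-trans (≤-reflexive (size-∷ (cheapest J v vs , u) J))
    (+-monoʳ-≤ ⟪ J ⟫ (s≤s (s≤s (+-mono-≤
      (≤-trans (size-cheapest J v vs)
        (≤-trans (≤-reflexive (cong ⟪_⟫ (sym S-eq))) (size-filter _ items)))
      (≤-trans (node≤⇒left≤ ⌜ u ⌝ ⌜ us ⌝ ≤-refl)
        (≤-trans (≤-reflexive (cong ⟪_⟫ (sym I-eq))) (size-filter _ I)))))))

  auctionᶠ : {Γ : Set} {{_ : Encodable Γ}} {A : Γ → Matrix} {l : Γ → ℕ} {items I : Γ → List ℕ} {F : Γ → List (ℕ × ℕ)} →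
             Feasible A → Feasible l → Feasible items → Feasible I → Feasible F →
             Feasible (λ γ → auction (A γ) (l γ) (items γ) (I γ) (F γ))
  auctionᶠ {A = A} {l} {items} {I} AF L S IF FF = foldrᶠ {f = λ γ _ → bid (A γ) (l γ) (items γ) (I γ)}
    (bidᶠ (AF ∘ᶠ π) (L ∘ᶠ π) (S ∘ᶠ π) (IF ∘ᶠ π) sndᶠ)
    (♯ 2 ⊕ (cost S ⊕ cost IF))
    (λ γ e J → ≤-trans (size-bid (A γ) (l γ) (items γ) (I γ) J)
      (+-monoʳ-≤ ⟪ J ⟫ (s≤s (s≤s (+-mono-≤
        (≤-trans (size-bound S γ) (⟦⟧-mono (cost S) (node≤⇒left≤ ⌜ γ ⌝ ⌜ e ⌝ ≤-refl)))
        (≤-trans (size-bound IF γ) (⟦⟧-mono (cost IF) (node≤⇒left≤ ⌜ γ ⌝ ⌜ e ⌝ ≤-refl))))))))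
    []ᶠ FF
    where
    π = fstᶠ ∘ᶠ fstᶠ

  unmatchedᶠ : {Γ : Set} {{_ : Encodable Γ}} {vs : Γ → List ℕ} {M : Γ → List (ℕ × ℕ)} →
               Feasible vs → Feasible M → Feasible (λ γ → unmatched (vs γ) (M γ))
  unmatchedᶠ {M = M} VS MF = filterᶠ {P? = λ γ w → ¬? (w ∈? endpoints (M γ))}
    (notᶠ (sndᶠ ∈?ᶠ endpointsᶠ (MF ∘ᶠ fstᶠ))) VS

  bidsᶠ : {Γ : Set} {{_ : Encodable Γ}} {A : Γ → Matrix} {vs : Γ → List ℕ} {M : Γ → List (ℕ × ℕ)} →
          Feasible A → Feasible vs → Feasible M → Feasible (λ γ → bids (A γ) (vs γ) (M γ))
  bidsᶠ AF VS MF = auctionᶠ AF (lengthᶠ VS) (endpointsᶠ MF) (unmatchedᶠ VS MF) (cartesianProductᶠ VS VS)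

  removeCrownᶠ : {Γ : Set} {{_ : Encodable Γ}} {vs : Γ → List ℕ} {k u : Γ → ℕ} {X : Γ → List (ℕ × ℕ)} →
                 Feasible vs → Feasible k → Feasible u → Feasible X →
                 Feasible (λ γ → removeCrown (vs γ) (k γ) (u γ) (X γ))
  removeCrownᶠ {u = u} {X} VS K U XF =
    filterᶠ {P? = λ γ w → ¬? (w ∈? u γ ∷ endpoints (X γ))}
      (notᶠ (sndᶠ ∈?ᶠ ((U ∘ᶠ fstᶠ) ∷ᶠ endpointsᶠ (XF ∘ᶠ fstᶠ)))) VS
    ,ᶠ (K ∸ᶠ lengthᶠ XF)

  reduceByᶠ : {Γ : Set} {{_ : Encodable Γ}} {A : Γ → Matrix} {vs : Γ → List ℕ} {k : Γ → ℕ} {M : Γ → List (ℕ × ℕ)} →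
              Feasible A → Feasible vs → Feasible k → Feasible M →
              Feasible (λ γ → reduceBy (A γ) (vs γ) (k γ) (M γ))
  reduceByᶠ AF VS K MF = caseᶠ (unservedᶠ (unmatchedᶠ VS MF) (bidsᶠ AF VS MF)) (constᶠ ([] , 0))
    (removeCrownᶠ (VS ∘ᶠ fstᶠ) (K ∘ᶠ fstᶠ) (fstᶠ ∘ᶠ sndᶠ)
      (aboveᶠ (gapᶠ (lengthᶠ VS) (endpointsᶠ MF) (bidsᶠ AF VS MF)) (bidsᶠ AF VS MF) ∘ᶠ fstᶠ))

  opaque
    unfolding reduceLarge

    reduceLargeᶠ : {Γ : Set} {{_ : Encodable Γ}} {A : Γ → Matrix} {s : Γ → List ℕ × ℕ} {M : Γ → List (ℕ × ℕ)} →
                   Feasible A → Feasible s → Feasible M → Feasible (λ γ → reduceLarge (A γ) (s γ) (M γ))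
    reduceLargeᶠ {A = A} {s} {M} AF S MF = ifᶠ
      {f = λ _ → [] , 0} {g = λ γ → reduceBy (A γ) (proj₁ (s γ)) (proj₂ (s γ)) (M γ)}
      ((sndᶠ ∘ᶠ S) ≤?ᶠ lengthᶠ MF) (constᶠ ([] , 0))
      (reduceByᶠ {A = A} {proj₁ ∘ s} {proj₂ ∘ s} {M} AF (fstᶠ ∘ᶠ S) (sndᶠ ∘ᶠ S) MF)

  reduceᶠ : {Γ : Set} {{_ : Encodable Γ}} {A : Γ → Matrix} {s : Γ → List ℕ × ℕ} →
            Feasible A → Feasible s → Feasible (λ γ → reduce (A γ) (s γ))
  reduceᶠ {A = A} {s} AF S = ifᶠ {f = s} {g = λ γ → reduceLarge (A γ) (s γ) (greedyMatching (A γ) (proj₁ (s γ)))}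
    (lengthᶠ (fstᶠ ∘ᶠ S) ≤?ᶠ ((constᶠ 3 *ᶠ (sndᶠ ∘ᶠ S)) ∸ᶠ constᶠ 3)) S
    (reduceLargeᶠ {A = A} {s} {λ γ → greedyMatching (A γ) (proj₁ (s γ))} AF S (greedyMatchingᶠ AF (fstᶠ ∘ᶠ S)))

  size-if : {B : Set} {{_ : Encodable B}} {n : ℕ} (c : Bool) {x y : B} →
            ⟪ x ⟫ ≤ n → ⟪ y ⟫ ≤ n → ⟪ if c then x else y ⟫ ≤ n
  size-if true  x≤ y≤ = x≤
  size-if false x≤ y≤ = y≤

  size-caseList : {B C : Set} {{_ : Encodable C}} {n : ℕ} (xs : List B) {z : C} {s : B → List B → C} →
                  ⟪ z ⟫ ≤ n → (∀ x ys → ⟪ s x ys ⟫ ≤ n) → ⟪ caseList xs z s ⟫ ≤ n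
  size-caseList []       z≤ s≤ = z≤
  size-caseList (x ∷ xs) z≤ s≤ = s≤ x xs

  size-removeCrown : ∀ vs k u X → ⟪ removeCrown vs k u X ⟫ ≤ ⟪ (vs , k) ⟫
  size-removeCrown vs k u X = s≤s (+-mono-≤ (size-filter (λ w → ¬? (w ∈? u ∷ endpoints X)) vs) (size-∸ k (length X)))

  -- Removing a crown only shrinks the state; 3 is the size of `([] , 0)`.
  size-reduceBy : ∀ A vs k M → ⟪ reduceBy A vs k M ⟫ ≤ ⟪ (vs , k) ⟫ + 3
  size-reduceBy A vs k M = size-caseList {C = List ℕ × ℕ} (unserved (unmatched vs M) (bids A vs M))
    (m≤n+m 3 ⟪ (vs , k) ⟫)
    (λ u _ → ≤-trans (size-removeCrown vs k u (above (gap (length vs) (endpoints M) (bids A vs M)) (bids A vs M))) (m≤m+n ⟪ (vs , k) ⟫ 3))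

  opaque
    unfolding reduceLarge

    size-reduceLarge : ∀ A s M → ⟪ reduceLarge A s M ⟫ ≤ ⟪ s ⟫ + 3
    size-reduceLarge A s M =
      size-if {n = ⟪ s ⟫ + 3} (does (proj₂ s ≤? length M)) {[] , 0} {reduceBy A (proj₁ s) (proj₂ s) M}
        (m≤n+m 3 ⟪ s ⟫) (size-reduceBy A (proj₁ s) (proj₂ s) M)

  size-reduce : ∀ A s → ⟪ reduce A s ⟫ ≤ ⟪ s ⟫ + 3
  size-reduce A s =
    size-if {n = ⟪ s ⟫ + 3} (does (length (proj₁ s) ≤? 3 * proj₂ s ∸ 3)) {s} {reduceLarge A s (greedyMatching A (proj₁ s))}
      (m≤m+n ⟪ s ⟫ 3) (size-reduceLarge A s (greedyMatching A (proj₁ s)))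

  kernelizeᶠ : {Γ : Set} {{_ : Encodable Γ}} {A : Γ → Matrix} {n k : Γ → ℕ} →
               Feasible A → Feasible n → Feasible k → Feasible (λ γ → kernelize (A γ) (n γ) (k γ))
  kernelizeᶠ {A = A} {n} {k} AF N K = foldrᶠ {f = λ γ _ → reduce (A γ)} {λ γ → downFrom (n γ) , k γ}
    (reduceᶠ {A = λ p → A (proj₁ (proj₁ p))} {proj₂} (AF ∘ᶠ fstᶠ ∘ᶠ fstᶠ) sndᶠ) (♯ 3)
    (λ γ _ s → size-reduce (A γ) s) (downFromᶠ N ,ᶠ K) (downFromᶠ N)

-- Storage capacity of induced subgraphs

length-filter-split : {A : Set} {P : A → Set} (P? : Decidable P) (xs : List A) →
                      length (filter P? xs) + length (filter (¬? ∘ P?) xs) ≡ length xs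
length-filter-split P? []       = refl
length-filter-split P? (x ∷ xs) with does (P? x)
... | true  = cong suc (length-filter-split P? xs)
... | false = trans (+-suc _ _) (cong suc (length-filter-split P? xs))

-- Values are discarded one by one: if at most `N` elements take the value `c`, those left are still
-- more than `N` times the number of remaining values.
pigeonhole : {A : Set} {q : ℕ} (f : A → Fin q) (N : ℕ) (cs : List (Fin q)) (xs : List A) →
             All (λ x → f x ∈ cs) xs → length cs * N < length xs →
             ∃[ c ] N < length (filter (λ x → f x Fin.≟ c) xs)
pigeonhole f N []       (x ∷ xs) (() ∷ _) _
pigeonhole f N (c ∷ cs) xs       fs∈ <len with N <? length (filter (λ x → f x Fin.≟ c) xs)
... | yes N< = c , N<
... | no  N≮ with pigeonhole f N cs (filter (λ x → ¬? (f x Fin.≟ c)) xs) rest∈ rest<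
  where
  P? = λ x → f x Fin.≟ c
  drop-head : ∀ {x} → f x ∈ c ∷ cs → f x ≢ c → f x ∈ cs
  drop-head (here fx≡c)  fx≢c = contradiction fx≡c fx≢c
  drop-head (there fx∈)  _    = fx∈
  rest∈ : All (λ x → f x ∈ cs) (filter (¬? ∘ P?) xs)
  rest∈ = All.tabulate λ x∈ → let (x∈xs , fx≢c) = ∈-filter⁻ (¬? ∘ P?) x∈ in
            drop-head (All.lookup fs∈ x∈xs) fx≢c
  rest< : length cs * N < length (filter (¬? ∘ P?) xs)
  rest< = +-cancelˡ-< N _ _ (<-≤-trans <len (≤-trans (≤-reflexive (sym (length-filter-split P? xs)))
            (+-monoˡ-≤ _ (≮⇒≥ N≮))))
... | d , N< = d , <-≤-trans N< (filter-filter xs)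
  where
  filter-filter : ∀ ys → length (filter (λ x → f x Fin.≟ d) (filter (λ x → ¬? (f x Fin.≟ c)) ys)) ≤
                         length (filter (λ x → f x Fin.≟ d) ys)
  filter-filter []       = z≤n
  filter-filter (y ∷ ys) with does (f y Fin.≟ c)
  ... | true with does (f y Fin.≟ d)
  ...   | true  = m≤n⇒m≤1+n (filter-filter ys)
  ...   | false = filter-filter ys
  filter-filter (y ∷ ys) | false with does (f y Fin.≟ d)
  ...   | true  = s≤s (filter-filter ys)
  ...   | false = filter-filter ys

module _ {A : Set} {R : A → A → Set} where

  AllPairs-fromAll : {P : A → Set} → (∀ {x y} → P x → P y → R x y) → ∀ {xs} → All P xs → AllPairs R xs
  AllPairs-fromAll PPR []         = []
  AllPairs-fromAll PPR (px ∷ pxs) = All.map (PPR px) pxs ∷ AllPairs-fromAll PPR pxs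

  AllPairs-lookup : (∀ {x y} → R x y → R y x) → ∀ {xs x y} → AllPairs R xs → x ∈ xs → y ∈ xs → x ≡ y ⊎ R x y
  AllPairs-lookup R-sym (_ ∷ _)   (here refl) (here refl) = inj₁ refl
  AllPairs-lookup R-sym (Rx ∷ _)  (here refl) (there y∈)  = inj₂ (All.lookup Rx y∈)
  AllPairs-lookup R-sym (Ry ∷ _)  (there x∈)  (here refl) = inj₂ (R-sym (All.lookup Ry x∈))
  AllPairs-lookup R-sym (_ ∷ Rxs) (there x∈)  (there y∈)  = AllPairs-lookup R-sym Rxs x∈ y∈

module Capacity (adj : ℕ → ℕ → Bool) (p : ℕ) where

  q : ℕ
  q = suc p

  Word : Set
  Word = ℕ → Fin q

  Agree : List ℕ → Word → Word → Set
  Agree vs x y = ∀ v → v ∈ vs → x v ≡ y v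

  Recovers : List ℕ → Word → Word → Set
  Recovers vs x y = ∀ i → i ∈ vs → (∀ j → j ∈ vs → T (adj i j) → x j ≡ y j) → x i ≡ y i

  -- The storage condition concerns pairs of words, so a code is a list of pairwise compatible
  -- words. Disagreement on `vs` replaces inequality: words also carry letters outside `vs`, and
  -- these must not count.
  Compatible : List ℕ → Word → Word → Set
  Compatible vs x y = ¬ Agree vs x y × Recovers vs x y

  Capacity≥ : List ℕ → ℕ → Set
  Capacity≥ vs k = ∃[ ws ] (AllPairs (Compatible vs) ws × q ^ k ≤ length ws)

  compatible-sym : ∀ {vs x y} → Compatible vs x y → Compatible vs y x
  compatible-sym (x≉y , rec) = (λ y≈x → x≉y λ v v∈ → sym (y≈x v v∈)) ,
    λ i i∈ agree → sym (rec i i∈ λ j j∈ i~j → sym (agree j j∈ i~j))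

  code-recovers : ∀ {vs ws x y} → AllPairs (Compatible vs) ws → x ∈ ws → y ∈ ws → Recovers vs x y
  code-recovers {vs} code x∈ y∈ with AllPairs-lookup (compatible-sym {vs}) code x∈ y∈
  ... | inj₁ refl      = λ _ _ _ → refl
  ... | inj₂ (_ , rec) = rec

  capacity≥0 : ∀ vs → Capacity≥ vs 0
  capacity≥0 vs = (λ _ → zero) ∷ [] , [] ∷ [] , ≤-refl

  capacity-antimono : ∀ {vs k k′} → k ≤ k′ → Capacity≥ vs k′ → Capacity≥ vs k
  capacity-antimono k≤k′ (ws , code , ≤len) = ws , code , ≤-trans (^-monoʳ-≤ q k≤k′) ≤len

  -- For each position of `hs` the most frequent letter occurs in at least a fraction 1/q of the
  -- words. `R` is arbitrary so that the recursion can carry along the agreement on the positions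
  -- already fixed.
  fix-letters : ∀ {R : Word → Word → Set} hs k ws → AllPairs R ws → q ^ (length hs + k) ≤ length ws →
                ∃[ ws′ ] (AllPairs R ws′ × AllPairs (Agree hs) ws′ × q ^ k ≤ length ws′)
  fix-letters [] k ws Rws ≤len = ws , Rws , AllPairs.map (λ _ _ ()) Rws , ≤len
  fix-letters {R} (h ∷ hs) k ws Rws ≤len =
    -- `pred N` converts between the strict bounds of the pigeonhole principle and the required size
    -- `N`, a power of q and hence positive.
    let (c , N<) = pigeonhole (λ x → x h) (pred N) (allFin q) ws (All.tabulate λ _ → ∈-allFin _) <len
        eq? = λ (x : Word) → x h Fin.≟ c
        same = AllPairs-fromAll {R = λ x y → x h ≡ y h} (λ x≡ y≡ → trans x≡ (sym y≡)) (All.all-filter eq? ws)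
        (ws′ , both , agree , ≤len′) = fix-letters {λ x y → R x y × x h ≡ y h} hs k (filter eq? ws)
          (AllPairs.zip (AllPairs.filter⁺ eq? Rws , same)) (≤-trans (≤-reflexive (sym (suc-pred N))) N<)
    in ws′ , AllPairs.map proj₁ both ,
       AllPairs.zipWith (λ { ((_ , e) , a) v (here refl) → e ; ((_ , e) , a) v (there v∈) → a v v∈ }) (both , agree) , ≤len′
    where
    N = q ^ (length hs + k)
    instance
      N≢0 : NonZero N
      N≢0 = m^n≢0 q (length hs + k)
    <len : length (allFin q) * pred N < length ws
    <len = <-≤-trans (subst (λ l → l * pred N < q * N) (sym (length-tabulate {n = q} id))
                       (*-monoʳ-< q (≤-reflexive (suc-pred N)))) ≤len

  -- Once the letters on `S` are fixed, a vertex whose neighbours all lie in `S` is constant on the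
  -- code, so words that differ on `vs` still differ on `vs′`. A vertex of `vs′` loses only
  -- neighbours in `S`, which carried no information any more.
  delete-crown : ∀ {vs vs′ k} S →
    (∀ v → v ∈ vs → v ∈ vs′ ⊎ v ∈ S ⊎ (∀ w → w ∈ vs → T (adj v w) → w ∈ S)) →
    (∀ v → v ∈ vs′ → v ∈ vs × (∀ w → w ∈ vs → T (adj v w) → w ∈ vs′ ⊎ w ∈ S)) →
    Capacity≥ vs (length S + k) → Capacity≥ vs′ k
  delete-crown {vs} {vs′} {k} S cover closed (ws , code , ≤len) =
    let (ws′ , code′ , agree , ≤len′) = fix-letters S k ws code ≤len in
    ws′ , AllPairs.zipWith restrict (code′ , agree) , ≤len′
    where
    restrict : ∀ {x y} → Compatible vs x y × Agree S x y → Compatible vs′ x y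
    restrict {x} {y} ((x≉y , rec) , fixed) = x≉y ∘ extend , rec′
      where
      extend : Agree vs′ x y → Agree vs x y
      extend agree v v∈ with cover v v∈
      ... | inj₁ v∈vs′          = agree v v∈vs′
      ... | inj₂ (inj₁ v∈S)     = fixed v v∈S
      ... | inj₂ (inj₂ nbrs∈S)  = rec v v∈ λ w w∈ v~w → fixed w (nbrs∈S w w∈ v~w)
      rec′ : Recovers vs′ x y
      rec′ i i∈ agree = rec i (proj₁ (closed i i∈)) nbr
        where
        nbr : ∀ j → j ∈ vs → T (adj i j) → x j ≡ y j
        nbr j j∈ i~j with proj₂ (closed i i∈) j j∈ i~j
        ... | inj₁ j∈vs′ = agree j j∈vs′ i~j
        ... | inj₂ j∈S   = fixed j j∈S

  -- The new vertices get the constant letter `zero` and are recovered without any information.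
  enlarge : ∀ {us vs k} → (∀ {v} → v ∈ us → v ∈ vs) → Capacity≥ us k → Capacity≥ vs k
  enlarge {us} {vs} us⊆vs (ws , code , ≤len) =
    map pad ws , AllPairs.map⁺ (AllPairs.map padded code) , ≤-trans ≤len (≤-reflexive (sym (length-map pad ws)))
    where
    pad : Word → Word
    pad x v with v ∈? us
    ... | yes _ = x v
    ... | no  _ = zero
    pad-∈ : ∀ x {v} → v ∈ us → pad x v ≡ x v
    pad-∈ x {v} v∈ with v ∈? us
    ... | yes _  = refl
    ... | no v∉  = contradiction v∈ v∉
    unpad : ∀ {x y v} → v ∈ us → pad x v ≡ pad y v → x v ≡ y v
    unpad {x} {y} v∈ e = trans (sym (pad-∈ x v∈)) (trans e (pad-∈ y v∈))
    padded : ∀ {x y} → Compatible us x y → Compatible vs (pad x) (pad y)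
    padded {x} {y} (x≉y , rec) = (λ agree → x≉y λ v v∈ → unpad v∈ (agree v (us⊆vs v∈))) , rec′
      where
      rec′ : Recovers vs (pad x) (pad y)
      rec′ i _ agree with i ∈? us
      ... | no  _  = refl
      ... | yes i∈ = rec i i∈ λ j j∈ i~j → unpad j∈ (agree j (us⊆vs j∈) i~j)

  module _ (adj-sym : ∀ u v → T (adj u v) → T (adj v u)) where

    -- Both endpoints of the new edge carry the same, freely chosen letter.
    add-edge : ∀ {u v vs k} → T (adj u v) → u ∉ vs → v ∉ vs → Capacity≥ vs k → Capacity≥ (u ∷ v ∷ vs) (suc k)
    add-edge {u} {v} {vs} {k} u~v u∉ v∉ (ws , code , ≤len) =
      extensions (allFin q) , code′ (allFin q) (Unique.allFin⁺ q) ,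
      ≤-trans (*-monoʳ-≤ q ≤len) (≤-reflexive (sym (trans (length-extensions (allFin q))
        (cong (_* length ws) (length-tabulate {n = q} id)))))
      where
      put : Fin q → Word → Word
      put c x w with w ∈? u ∷ v ∷ []
      ... | yes _ = c
      ... | no  _ = x w
      put-∈ : ∀ c x {w} → w ∈ u ∷ v ∷ [] → put c x w ≡ c
      put-∈ c x {w} w∈ with w ∈? u ∷ v ∷ []
      ... | yes _  = refl
      ... | no w∉  = contradiction w∈ w∉
      ∉edge : ∀ {w} → w ∈ vs → w ∉ u ∷ v ∷ []
      ∉edge w∈ (here refl)         = u∉ w∈
      ∉edge w∈ (there (here refl)) = v∉ w∈
      put-vs : ∀ c x {w} → w ∈ vs → put c x w ≡ x w
      put-vs c x {w} w∈ with w ∈? u ∷ v ∷ []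
      ... | yes w∈e = contradiction w∈e (∉edge w∈)
      ... | no  _   = refl
      extensions : List (Fin q) → List Word
      extensions = concatMap λ c → map (put c) ws
      length-extensions : ∀ cs → length (extensions cs) ≡ length cs * length ws
      length-extensions []       = refl
      length-extensions (c ∷ cs) = trans (length-++ (map (put c) ws))
        (cong₂ _+_ (length-map (put c) ws) (length-extensions cs))
      recovers : ∀ {c d x y} → Recovers vs x y → Recovers (u ∷ v ∷ vs) (put c x) (put d y)
      recovers {c} {d} {x} {y} rec i (here refl) agree =
        trans (put-∈ c x (here refl)) (trans (sym (put-∈ c x (there (here refl))))
          (trans (agree v (there (here refl)) u~v) (trans (put-∈ d y (there (here refl))) (sym (put-∈ d y (here refl))))))
      recovers {c} {d} {x} {y} rec i (there (here refl)) agree =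
        trans (put-∈ c x (there (here refl))) (trans (sym (put-∈ c x (here refl)))
          (trans (agree u (here refl) (adj-sym u v u~v)) (trans (put-∈ d y (here refl)) (sym (put-∈ d y (there (here refl)))))))
      recovers {c} {d} {x} {y} rec i (there (there i∈)) agree =
        trans (put-vs c x i∈) (trans (rec i i∈ λ j j∈ i~j →
          trans (sym (put-vs c x j∈)) (trans (agree j (there (there j∈)) i~j) (put-vs d y j∈)))
          (sym (put-vs d y i∈)))
      code′ : ∀ cs → Unique cs → AllPairs (Compatible (u ∷ v ∷ vs)) (extensions cs)
      code′ []       []           = []
      code′ (c ∷ cs) (c∉cs ∷ cs!) = AllPairs.++⁺
        (AllPairs.map⁺ (AllPairs.map (λ {x} {y} (x≉y , rec) →
          (λ agree → x≉y λ w w∈ → trans (sym (put-vs c x w∈)) (trans (agree w (there (there w∈))) (put-vs c y w∈))) ,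
          recovers {c} {c} {x} {y} rec) code))
        (code′ cs cs!)
        (All.tabulate λ x∈ → All.tabulate λ y∈ → cross x∈ y∈)
        where
        -- Words with different new letters already differ at `u`, even if they extend the same old
        -- word.
        cross : ∀ {x y} → x ∈ map (put c) ws → y ∈ extensions cs → Compatible (u ∷ v ∷ vs) x y
        cross x∈ y∈ with ∈-map⁻ (put c) x∈ | find (∈-concatMap⁻ (λ d → map (put d) ws) {xs = cs} y∈)
        ... | x , x∈ws , refl | d , d∈cs , y∈d with ∈-map⁻ (put d) y∈d
        ... | y , y∈ws , refl =
          (λ agree → All.lookup c∉cs d∈cs (trans (sym (put-∈ c x (here refl)))
            (trans (agree u (here refl)) (put-∈ d y (here refl))))) ,
          recovers {c} {d} {x} {y} (code-recovers code x∈ws y∈ws)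

    add-matching : ∀ {vs k} M → All (λ (u , v) → T (adj u v)) M → Unique (endpoints M ++ vs) →
                   Capacity≥ vs k → Capacity≥ (endpoints M ++ vs) (length M + k)
    add-matching []             []          _   cap = cap
    add-matching {k = k} ((u , v) ∷ M) (u~v ∷ M~) ((u≢v ∷ u∉) ∷ v∉ ∷ M!) cap =
      add-edge {k = length M + k} u~v (λ u∈ → All.lookup u∉ u∈ refl) (λ v∈ → All.lookup v∉ v∈ refl) (add-matching {k = k} M M~ M! cap)

    matching-bound : ∀ {vs} M → All (λ (u , v) → T (adj u v)) M → Unique (endpoints M) →
                     (∀ {v} → v ∈ endpoints M → v ∈ vs) → Capacity≥ vs (length M)
    matching-bound {vs} M M~ M! M⊆ = enlarge {k = length M} (λ v∈ → M⊆ (subst (_ ∈_) (++-identityʳ (endpoints M)) v∈))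
      (subst (Capacity≥ (endpoints M ++ [])) (+-identityʳ (length M))
        (add-matching {k = 0} M M~ (subst Unique (sym (++-identityʳ (endpoints M))) M!) (capacity≥0 [])))

    -- Fixing the heads loses at most `length X` of the capacity, and the edges of `X`, disjoint
    -- from `vs′`, give as much back.
    crown-equivalence : ∀ {vs vs′ k} X → All (λ (u , v) → T (adj u v)) X → Unique (endpoints X ++ vs′) →
      (∀ {v} → v ∈ endpoints X ++ vs′ → v ∈ vs) →
      (∀ v → v ∈ vs → v ∈ vs′ ⊎ v ∈ map proj₁ X ⊎ (∀ w → w ∈ vs → T (adj v w) → w ∈ map proj₁ X)) →
      (Capacity≥ vs k → Capacity≥ vs′ (k ∸ length X)) × (Capacity≥ vs′ (k ∸ length X) → Capacity≥ vs k)
    crown-equivalence {vs} {vs′} {k} X X~ X! ⊆vs cover = forward , backward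
      where
      S = map proj₁ X
      closed : ∀ v → v ∈ vs′ → v ∈ vs × (∀ w → w ∈ vs → T (adj v w) → w ∈ vs′ ⊎ w ∈ S)
      closed v v∈ = ⊆vs (∈-++⁺ʳ (endpoints X) v∈) , λ w w∈ v~w → nbr w v~w (cover w w∈)
        where
        heads⊆endpoints : ∀ Y {w} → w ∈ map proj₁ Y → w ∈ endpoints Y
        heads⊆endpoints ((a , b) ∷ Y) (here refl) = here refl
        heads⊆endpoints ((a , b) ∷ Y) (there w∈)  = there (there (heads⊆endpoints Y w∈))
        disjoint : ∀ {us} → Unique (us ++ vs′) → v ∉ us
        disjoint (u∉ ∷ _) (here refl) = All.lookup u∉ (∈-++⁺ʳ _ v∈) refl
        disjoint (_ ∷ us!) (there v∈us) = disjoint us! v∈us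
        nbr : ∀ w → T (adj v w) → w ∈ vs′ ⊎ w ∈ S ⊎ (∀ u → u ∈ vs → T (adj w u) → u ∈ S) → w ∈ vs′ ⊎ w ∈ S
        nbr w v~w (inj₁ w∈)           = inj₁ w∈
        nbr w v~w (inj₂ (inj₁ w∈))    = inj₂ w∈
        -- A kept vertex adjacent to such a `w` would itself be a head, but heads are not kept.
        nbr w v~w (inj₂ (inj₂ nbrs∈)) = contradiction
          (heads⊆endpoints X (nbrs∈ v (⊆vs (∈-++⁺ʳ (endpoints X) v∈)) (adj-sym v w v~w))) (disjoint X!)
      forward : Capacity≥ vs k → Capacity≥ vs′ (k ∸ length X)
      forward cap with ≤-total k (length X)
      ... | inj₁ k≤ = subst (Capacity≥ vs′) (sym (m≤n⇒m∸n≡0 k≤)) (capacity≥0 vs′)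
      ... | inj₂ ≤k = delete-crown {k = k ∸ length X} S cover closed
        (subst (Capacity≥ vs) (sym (trans (cong (_+ (k ∸ length X)) (length-map proj₁ X)) (m+[n∸m]≡n ≤k))) cap)
      backward : Capacity≥ vs′ (k ∸ length X) → Capacity≥ vs k
      -- The inequality also covers `k < length X`, where the subtraction is truncated.
      backward cap = capacity-antimono {k′ = length X + (k ∸ length X)} (m≤n+m∸n k (length X))
        (enlarge {k = length X + (k ∸ length X)} ⊆vs (add-matching {k = k ∸ length X} X X~ X! cap))

-- Lists of words and storage codes as subsets

unique-⊆⇒length≤ : {A : Set} {xs ys : List A} → Unique xs → (∀ {x} → x ∈ xs → x ∈ ys) → length xs ≤ length ys
unique-⊆⇒length≤ []          xs⊆ys = z≤n
unique-⊆⇒length≤ {xs = x ∷ xs} (x∉xs ∷ xs!) xs⊆ys with ∈-∃++ (xs⊆ys (here refl))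
... | as , bs , refl = ≤-trans (s≤s (unique-⊆⇒length≤ xs! xs⊆rest))
  (≤-reflexive (trans (cong suc (length-++ as)) (trans (sym (+-suc (length as) (length bs))) (sym (length-++ as)))))
  where
  xs⊆rest : ∀ {y} → y ∈ xs → y ∈ as ++ bs
  xs⊆rest y∈ with ∈-++⁻ as (xs⊆ys (there y∈))
  ... | inj₁ y∈as           = ∈-++⁺ˡ y∈as
  ... | inj₂ (here refl)    = contradiction refl (All.lookup x∉xs y∈)
  ... | inj₂ (there y∈bs)   = ∈-++⁺ʳ as y∈bs

members : ∀ {n} → Subset n → List (Fin n)
members Vec.[]            = []
members (inside Vec.∷ p)  = zero ∷ map suc (members p)
members (outside Vec.∷ p) = map suc (members p)

length-members : ∀ {n} (p : Subset n) → length (members p) ≡ ∣ p ∣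
length-members Vec.[]            = refl
length-members (inside Vec.∷ p)  = cong suc (trans (length-map suc (members p)) (length-members p))
length-members (outside Vec.∷ p) = trans (length-map suc (members p)) (length-members p)

members-unique : ∀ {n} (p : Subset n) → Unique (members p)
members-unique Vec.[]            = []
members-unique (inside Vec.∷ p)  = All.map⁺ (All.universal (λ _ ()) (members p)) ∷ Unique.map⁺ Fin.suc-injective (members-unique p)
members-unique (outside Vec.∷ p) = Unique.map⁺ Fin.suc-injective (members-unique p)

∈-members⁺ : ∀ {n} {p : Subset n} {x} → x Subset.∈ p → x ∈ members p
∈-members⁺ {p = inside Vec.∷ p}  Vec.here       = here refl
∈-members⁺ {p = inside Vec.∷ p}  (Vec.there x∈) = there (∈-map⁺ suc (∈-members⁺ x∈))
∈-members⁺ {p = outside Vec.∷ p} (Vec.there x∈) = ∈-map⁺ suc (∈-members⁺ x∈)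

members-⊆ : ∀ {n} (p : Subset n) → All (Subset._∈ p) (members p)
members-⊆ Vec.[]            = []
members-⊆ (inside Vec.∷ p)  = Vec.here ∷ All.map⁺ (All.map Vec.there (members-⊆ p))
members-⊆ (outside Vec.∷ p) = All.map⁺ (All.map Vec.there (members-⊆ p))

-- `Cap≥` asks for the exact maximum. It is found by lowering an upper bound until it is attained,
-- each test being an exhaustive search over subsets.
largest : ∀ {n} {P : Subset n → Set} → Decidable P → ∃[ p ] P p →
          ∃[ M ] ((∃[ p ] (P p × ∣ p ∣ ≡ M)) × (∀ p → P p → ∣ p ∣ ≤ M))
largest {n} {P} P? (p₀ , Pp₀) = search n λ p _ → ∣p∣≤n p
  where
  search : ∀ b → (∀ p → P p → ∣ p ∣ ≤ b) → ∃[ M ] ((∃[ p ] (P p × ∣ p ∣ ≡ M)) × (∀ p → P p → ∣ p ∣ ≤ M))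
  search b bound with anySubset? (λ p → P? p ×-dec (∣ p ∣ ≟ b))
  search b       bound | yes found = b , found , bound
  search zero    bound | no  none  = contradiction (p₀ , Pp₀ , n≤0⇒n≡0 (bound p₀ Pp₀)) none
  search (suc b) bound | no  none  = search b λ p Pp → s≤s⁻¹ (≤∧≢⇒< (bound p Pp) λ ≡b → none (p , Pp , ≡b))

isStorageCode? : ∀ q G → Decidable (IsStorageCode q G)
isStorageCode? q G C =
  Fin.all? λ x → Fin.all? λ y → (x Subset.∈? C) →-dec ((y Subset.∈? C) →-dec Fin.all? λ i →
    (Fin.all? λ j → (adjacent G i j Bool.≟ true) →-dec (letter {q} G x j Fin.≟ letter {q} G y j)) →-dec
    (letter {q} G x i Fin.≟ letter {q} G y i))

cap≥⁺ : ∀ q G k C → IsStorageCode q G C → q ^ k ≤ ∣ C ∣ → Cap≥ q G k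
cap≥⁺ q G k C storage q^k≤ =
  let (M , attained , bound) = largest (isStorageCode? q G) (C , storage) in
  M , (attained , bound) , ≤-trans q^k≤ (bound C storage)

-- `φ` labels the vertices of `G` bijectively by the elements of `vs`. It is `toℕ` for the given
-- graph and `lookup vs` for the kernel, so both are measured inside the same `adj`.
module _ (adj : ℕ → ℕ → Bool) (p : ℕ) (G : Graph) (φ : Fin (order G) → ℕ) (vs : List ℕ)
         (φ-injective : ∀ {i j} → φ i ≡ φ j → i ≡ j)
         (φ-∈ : ∀ i → φ i ∈ vs) (φ-onto : ∀ {v} → v ∈ vs → ∃[ i ] φ i ≡ v)
         (φ-adjacent : ∀ i j → adjacent G i j ≡ adj (φ i) (φ j)) where

  open Capacity adj p

  private
    toWord : Fin (q ^ order G) → Word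
    toWord x v with Fin.any? (λ i → φ i ≟ v)
    ... | yes (i , _) = letter {q} G x i
    ... | no  _       = zero

    toWord-φ : ∀ x i → toWord x (φ i) ≡ letter {q} G x i
    toWord-φ x i with Fin.any? (λ j → φ j ≟ φ i)
    ... | yes (j , φj≡φi) = cong (letter {q} G x) (φ-injective φj≡φi)
    ... | no  none        = contradiction (i , refl) none

    fromWord : Word → Fin (q ^ order G)
    fromWord w = funToFin (w ∘ φ)

    letter-fromWord : ∀ w i → letter {q} G (fromWord w) i ≡ w (φ i)
    letter-fromWord w = finToFun-funToFin (w ∘ φ)

    funToFin-cong : ∀ {m n} {f g : Fin m → Fin n} → (∀ i → f i ≡ g i) → funToFin f ≡ funToFin g
    funToFin-cong {zero}  f≗g = refl
    funToFin-cong {suc m} f≗g = cong₂ Fin.combine (f≗g zero) (funToFin-cong (f≗g ∘ suc))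

    letters-injective : ∀ {x y} → (∀ i → letter {q} G x i ≡ letter {q} G y i) → x ≡ y
    letters-injective {x} {y} eq = trans (sym (funToFin-finToFin {order G} {q} x))
      (trans (funToFin-cong eq) (funToFin-finToFin {order G} {q} y))

  cap≥⇒capacity≥ : ∀ k → Cap≥ q G k → Capacity≥ vs k
  cap≥⇒capacity≥ k (M , ((C , storage , refl) , _) , q^k≤) =
    map toWord (members C) ,
    AllPairs.map⁺ (AllPairs.zipWith compatible (members-unique C , AllPairs-fromAll _,_ (members-⊆ C))) ,
    ≤-trans q^k≤ (≤-reflexive (sym (trans (length-map toWord (members C)) (length-members C))))
    where
    compatible : ∀ {x y} → x ≢ y × (x Subset.∈ C × y Subset.∈ C) → Compatible vs (toWord x) (toWord y)
    compatible {x} {y} (x≢y , x∈ , y∈) =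
      (λ agree → x≢y (letters-injective λ i → letter≡ i (agree (φ i) (φ-∈ i)))) , recovers
      where
      letter≡ : ∀ i → toWord x (φ i) ≡ toWord y (φ i) → letter {q} G x i ≡ letter {q} G y i
      letter≡ i e = trans (sym (toWord-φ x i)) (trans e (toWord-φ y i))
      recovers : Recovers vs (toWord x) (toWord y)
      recovers v v∈ agree with φ-onto v∈
      ... | i , refl = trans (toWord-φ x i) (trans (storage x y x∈ y∈ i λ j i~j →
              letter≡ j (agree (φ j) (φ-∈ j) (subst T (φ-adjacent i j) (Equivalence.from T-≡ i~j))))
              (sym (toWord-φ y i)))

  capacity≥⇒cap≥ : ∀ k → Capacity≥ vs k → Cap≥ q G k
  capacity≥⇒cap≥ k (ws , code , q^k≤) = cap≥⁺ q G k C storage (≤-trans q^k≤ ws≤C)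
    where
    hit? : ∀ x → Dec (Any (λ w → x ≡ fromWord w) ws)
    hit? x = any? (λ w → x Fin.≟ fromWord w) ws
    C : Code q G
    C = Vec.tabulate (λ x → isYes (hit? x))
    ∈C⁻ : ∀ {x} → x Subset.∈ C → Any (λ w → x ≡ fromWord w) ws
    ∈C⁻ {x} x∈ = toWitness {a? = hit? x} (Equivalence.from T-≡
      (trans (sym (Vec.lookup∘tabulate (λ x → isYes (hit? x)) x)) (Vec.[]=⇒lookup x∈)))
    ∈C⁺ : ∀ {w} → w ∈ ws → fromWord w Subset.∈ C
    ∈C⁺ {w} w∈ = Vec.lookup⇒[]= (fromWord w) C (trans (Vec.lookup∘tabulate (λ x → isYes (hit? x)) (fromWord w))
      (Equivalence.to T-≡ (fromWitness {a? = hit? (fromWord w)} (Any.map (cong fromWord) w∈))))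
    storage : IsStorageCode q G C
    storage x y x∈ y∈ i agree with find (∈C⁻ x∈) | find (∈C⁻ y∈)
    ... | w , w∈ , refl | u , u∈ , refl = trans (letter-fromWord w i)
          (trans (code-recovers code w∈ u∈ (φ i) (φ-∈ i) agree′) (sym (letter-fromWord u i)))
      where
      agree′ : ∀ v → v ∈ vs → T (adj (φ i) v) → w v ≡ u v
      agree′ v v∈ i~v with φ-onto v∈
      ... | j , refl = trans (sym (letter-fromWord w j))
            (trans (agree j (Equivalence.to T-≡ (subst T (sym (φ-adjacent i j)) i~v))) (letter-fromWord u j))
    distinct : Unique (map fromWord ws)
    distinct = AllPairs.map⁺ (AllPairs.map (λ {w} {u} (w≉u , _) e → w≉u λ v v∈ → same e (φ-onto v∈)) code)
      where
      same : ∀ {w u v} → fromWord w ≡ fromWord u → ∃[ i ] φ i ≡ v → w v ≡ u v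
      same {w} {u} e (i , refl) = trans (sym (letter-fromWord w i))
        (trans (cong (λ x → letter {q} G x i) e) (letter-fromWord u i))
    ws≤C : length ws ≤ ∣ C ∣
    ws≤C = subst₂ _≤_ (length-map fromWord ws) (length-members C)
      (unique-⊆⇒length≤ distinct λ x∈ → let (w , w∈ , e) = ∈-map⁻ fromWord x∈ in
        subst (_∈ members C) (sym e) (∈-members⁺ (∈C⁺ w∈)))

-- Correctness of the algorithm

if-elim : {B X : Set} (P : B → Set) (d : Dec X) {a b : B} → (X → P a) → (¬ X → P b) → P (if does d then a else b)
if-elim P (yes x) pa pb = pa x
if-elim P (no ¬x) pa pb = pb ¬x

caseList-elim : {A B : Set} (P : B → Set) (xs : List A) {z : B} {s : A → List A → B} →
                (xs ≡ [] → P z) → (∀ y ys → xs ≡ y ∷ ys → P (s y ys)) → P (caseList xs z s)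
caseList-elim P []       pz ps = pz refl
caseList-elim P (x ∷ xs) pz ps = ps x xs refl

filter≡[]⇒none : {A : Set} {P : A → Set} (P? : Decidable P) {xs : List A} →
                 filter P? xs ≡ [] → ∀ {x} → x ∈ xs → ¬ P x
filter≡[]⇒none P? {xs} eq x∈ px with subst (_ ∈_) eq (∈-filter⁺ P? x∈ px)
... | ()

∈-filter-∷ : {A : Set} {P : A → Set} (P? : Decidable P) {xs ys : List A} {y : A} →
             filter P? xs ≡ y ∷ ys → ∀ {x} → x ∈ y ∷ ys → x ∈ xs × P x
∈-filter-∷ P? eq x∈ = ∈-filter⁻ P? (subst (_ ∈_) (sym eq) x∈)

length-cartesianProduct : {A B : Set} (xs : List A) (ys : List B) →
                          length (cartesianProduct xs ys) ≡ length xs * length ys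
length-cartesianProduct []       ys = refl
length-cartesianProduct (x ∷ xs) ys = trans (length-++ (map (x ,_) ys))
  (cong₂ _+_ (length-map (x ,_) ys) (length-cartesianProduct xs ys))

∈-endpoints⁻ : ∀ M {w} → w ∈ endpoints M → w ∈ map proj₁ M ⊎ w ∈ map proj₂ M
∈-endpoints⁻ ((u , v) ∷ M) (here refl)         = inj₁ (here refl)
∈-endpoints⁻ ((u , v) ∷ M) (there (here refl)) = inj₂ (here refl)
∈-endpoints⁻ ((u , v) ∷ M) (there (there w∈)) with ∈-endpoints⁻ M w∈
... | inj₁ w∈₁ = inj₁ (there w∈₁)
... | inj₂ w∈₂ = inj₂ (there w∈₂)

length-endpoints : ∀ M → length (endpoints M) ≡ length M + length M
length-endpoints []            = refl
length-endpoints ((u , v) ∷ M) = cong suc (trans (cong suc (length-endpoints M)) (sym (+-suc (length M) (length M))))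

endpoints-unique : ∀ M → Unique (map proj₁ M) → Unique (map proj₂ M) →
                   (∀ {u v} → u ∈ map proj₁ M → v ∈ map proj₂ M → u ≢ v) → Unique (endpoints M)
endpoints-unique []            _            _            _  = []
endpoints-unique ((u , v) ∷ M) (u∉ ∷ M₁!) (v∉ ∷ M₂!) disjoint =
  (disjoint (here refl) (here refl) ∷ All.tabulate λ w∈ → u≢ (∈-endpoints⁻ M w∈)) ∷
  All.tabulate (λ w∈ → v≢ (∈-endpoints⁻ M w∈)) ∷
  endpoints-unique M M₁! M₂! (λ u∈ v∈ → disjoint (there u∈) (there v∈))
  where
  u≢ : ∀ {w} → w ∈ map proj₁ M ⊎ w ∈ map proj₂ M → u ≢ w
  u≢ (inj₁ w∈) = All.lookup u∉ w∈
  u≢ (inj₂ w∈) = disjoint (here refl) (there w∈)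
  v≢ : ∀ {w} → w ∈ map proj₁ M ⊎ w ∈ map proj₂ M → v ≢ w
  v≢ (inj₁ w∈) v≡w = disjoint (there w∈) (here refl) (sym v≡w)
  v≢ (inj₂ w∈) = All.lookup v∉ w∈

-- Prices and allocations

price-∷-≡ : ∀ v u J → price ((v , u) ∷ J) v ≡ suc (price J v)
price-∷-≡ v u J = cong length (filter-accept (λ b → v ≟ proj₁ b) {(v , u)} {J} refl)

price-∷-≢ : ∀ {w v} u J → w ≢ v → price ((v , u) ∷ J) w ≡ price J w
price-∷-≢ {w} {v} u J w≢v = cong length (filter-reject (λ b → w ≟ proj₁ b) {(v , u)} {J} w≢v)

price-mono : ∀ v u J w → price J w ≤ price ((v , u) ∷ J) w
price-mono v u J w with w ≟ v
... | yes refl = ≤-trans (n≤1+n _) (≤-reflexive (sym (price-∷-≡ v u J)))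
... | no  w≢v  = ≤-reflexive (sym (price-∷-≢ u J w≢v))

private
  ≢item? : ∀ v (c : ℕ × ℕ) → Dec (proj₁ c ≢ v)
  ≢item? v c = ¬? (proj₁ c ≟ v)

sold⊆ : ∀ J {b} → b ∈ sold J → b ∈ J
sold⊆ (b ∷ J) (here refl) = here refl
sold⊆ (b ∷ J) (there c∈)  = there (sold⊆ J (proj₁ (∈-filter⁻ (≢item? (proj₁ b)) c∈)))

-- An item may change hands but never becomes free again.
price>0⇒sold : ∀ J {v} → 0 < price J v → v ∈ map proj₁ (sold J)
price>0⇒sold ((w , u) ∷ J) {v} 0< = go (v ≟ w)
  where
  go : Dec (v ≡ w) → v ∈ map proj₁ (sold ((w , u) ∷ J))
  go (yes v≡w) = here v≡w
  go (no  v≢w) with ∈-map⁻ proj₁ (price>0⇒sold J (subst (0 <_) (price-∷-≢ u J v≢w) 0<))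
  ... | b , b∈ , refl = there (∈-map⁺ proj₁ (∈-filter⁺ (≢item? w) b∈ v≢w))

filter-unique-on : {A B : Set} (f : A → B) {P : A → Set} (P? : Decidable P) {xs : List A} →
                   Unique (map f xs) → Unique (map f (filter P? xs))
filter-unique-on f P? {[]}     []          = []
filter-unique-on f P? {x ∷ xs} (x∉ ∷ xs!) with does (P? x)
... | false = filter-unique-on f P? xs!
... | true  = All.tabulate (λ y∈ → All.lookup x∉ (subset y∈)) ∷ filter-unique-on f P? xs!
  where
  subset : ∀ {y} → y ∈ map f (filter P? xs) → y ∈ map f xs
  subset y∈ with ∈-map⁻ f y∈
  ... | z , z∈ , refl = ∈-map⁺ f (proj₁ (∈-filter⁻ P? z∈))

sold-items-unique : ∀ J → Unique (map proj₁ (sold J))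
sold-items-unique []      = []
sold-items-unique (b ∷ J) = All.tabulate b≢ ∷ filter-unique-on proj₁ (≢item? (proj₁ b)) (sold-items-unique J)
  where
  b≢ : ∀ {v} → v ∈ map proj₁ (filter (≢item? (proj₁ b)) (sold J)) → proj₁ b ≢ v
  b≢ v∈ with ∈-map⁻ proj₁ v∈
  ... | c , c∈ , refl = proj₂ (∈-filter⁻ (≢item? (proj₁ b)) {xs = sold J} c∈) ∘ sym

cheapest-∈ : ∀ J v vs → cheapest J v vs ∈ v ∷ vs
cheapest-∈ J v []       = here refl
cheapest-∈ J v (w ∷ vs) = if-elim (_∈ v ∷ w ∷ vs) (price J w ≤? price J (cheapest J v vs))
  (λ _ → there (here refl)) (λ _ → shift (cheapest-∈ J v vs))
  where
  shift : ∀ {x} → x ∈ v ∷ vs → x ∈ v ∷ w ∷ vs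
  shift (here eq)  = here eq
  shift (there x∈) = there (there x∈)

cheapest-≤ : ∀ J v vs {w} → w ∈ v ∷ vs → price J (cheapest J v vs) ≤ price J w
cheapest-≤ J v []       (here refl) = ≤-refl
cheapest-≤ J v (x ∷ vs) {w} w∈ = if-elim (λ y → price J y ≤ price J w) (price J x ≤? price J (cheapest J v vs))
  (λ x≤ → below x≤ w∈) (λ x≰ → above′ (<⇒≤ (≰⇒> x≰)) w∈)
  where
  below : price J x ≤ price J (cheapest J v vs) → w ∈ v ∷ x ∷ vs → price J x ≤ price J w
  below x≤ (here refl)         = ≤-trans x≤ (cheapest-≤ J v vs (here refl))
  below x≤ (there (here refl)) = ≤-refl
  below x≤ (there (there w∈))  = ≤-trans x≤ (cheapest-≤ J v vs (there w∈))
  above′ : price J (cheapest J v vs) ≤ price J x → w ∈ v ∷ x ∷ vs → price J (cheapest J v vs) ≤ price J w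
  above′ ≤x (here refl)         = cheapest-≤ J v vs (here refl)
  above′ ≤x (there (here refl)) = ≤x
  above′ ≤x (there (there w∈))  = cheapest-≤ J v vs (there w∈)

length-filter-filter : {A : Set} {P Q : A → Set} (P? : Decidable P) (Q? : Decidable Q)
                       (xs : List A) → length (filter P? (filter Q? xs)) ≤ length (filter P? xs)
length-filter-filter P? Q? []       = z≤n
length-filter-filter P? Q? (x ∷ xs) with does (Q? x)
... | false with does (P? x)
...   | true  = m≤n⇒m≤1+n (length-filter-filter P? Q? xs)
...   | false = length-filter-filter P? Q? xs
length-filter-filter P? Q? (x ∷ xs) | true with does (P? x)
...   | true  = s≤s (length-filter-filter P? Q? xs)
...   | false = length-filter-filter P? Q? xs

-- Every bid is counted in the price of its item; the bids on one item are split off at a time.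
length-bids≤ : ∀ limit items J → All (λ b → proj₁ b ∈ items) J → (∀ v → price J v ≤ limit) →
               length J ≤ length items * limit
length-bids≤ limit []           []      _       _      = z≤n
length-bids≤ limit []           (b ∷ J) (() ∷ _) _
length-bids≤ limit (v ∷ items)  J       J⊆      bound = ≤-trans
  (≤-reflexive (sym (length-filter-split (λ b → v ≟ proj₁ b) J)))
  (+-mono-≤ (bound v) (length-bids≤ limit items (filter (λ b → ¬? (v ≟ proj₁ b)) J)
    (All.tabulate λ b∈ → let (b∈J , v≢b) = ∈-filter⁻ (λ b → ¬? (v ≟ proj₁ b)) b∈ in
      [ (λ b≡v → contradiction (sym b≡v) v≢b) , id ]′ (uncons (All.lookup J⊆ b∈J)))
    (λ w → ≤-trans (length-filter-filter (λ b → w ≟ proj₁ b) (λ b → ¬? (v ≟ proj₁ b)) J) (bound w))))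
  where
  uncons : ∀ {w} → w ∈ v ∷ items → w ≡ v ⊎ w ∈ items
  uncons (here eq)  = inj₁ eq
  uncons (there w∈) = inj₂ w∈

-- If all of 1, ..., `limit` were attained, the list of the items' prices would contain `limit`
-- distinct values.
gap-spec : ∀ limit items J → length items < limit →
           let j = gap limit items J in 0 < j × j ≤ limit × (∀ {v} → v ∈ items → price J v ≢ j)
gap-spec limit items J items<limit = caseList-elim
  (λ j → 0 < j × j ≤ limit × (∀ {v} → v ∈ items → price J v ≢ j))
  (filter free? candidates) (λ none → contradiction (candidates≤ none) (<⇒≱ items<limit)) found
  where
  candidates : List ℕ
  candidates = map suc (downFrom limit)
  free? = λ j → ¬? (any? (λ v → price J v ≟ j) items)
  candidates≤ : filter free? candidates ≡ [] → limit ≤ length items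
  candidates≤ none = subst₂ _≤_ (trans (length-map suc (downFrom limit)) (length-downFrom limit)) (length-map (price J) items)
    (unique-⊆⇒length≤ (Unique.map⁺ suc-injective (Unique.downFrom⁺ limit)) λ {j} j∈ →
      let (v , v∈ , eq) = find (decidable-stable (any? (λ v → price J v ≟ j) items) (filter≡[]⇒none free? none j∈))
      in subst (_∈ map (price J) items) eq (∈-map⁺ (price J) v∈))
  found : ∀ j js → filter free? candidates ≡ j ∷ js → 0 < j × j ≤ limit × (∀ {v} → v ∈ items → price J v ≢ j)
  found j js eq with ∈-filter-∷ free? {xs = candidates} eq (here refl)
  ... | j∈ , free with ∈-map⁻ suc {xs = downFrom limit} j∈
  ... | i , i∈ , refl = s≤s z≤n , ∈-downFrom⁻ i∈ , λ v∈ eq′ → free (Any.map (λ { refl → eq′ }) v∈)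

-- Matchings, auction and crown

module Correctness (A : Matrix) (p : ℕ)
                   (~-sym : ∀ u v → T (entry A u v) → T (entry A v u))
                   (~-irrefl : ∀ u → ¬ T (entry A u u)) where

  open Search A
  open Capacity (entry A) p

  record Matching (vs : List ℕ) (M : List (ℕ × ℕ)) : Set where
    field
      edges    : All (λ (u , v) → u ~ v) M
      disjoint : Unique (endpoints M)
      within   : ∀ {v} → v ∈ endpoints M → v ∈ vs

  open Matching

  Extended : List ℕ → ℕ → ℕ → List (ℕ × ℕ) → List (ℕ × ℕ) → Set
  Extended vs u v M M′ = Matching vs M′ × (∀ {w} → w ∈ endpoints M → w ∈ endpoints M′) ×
                         (u ~ v → u ∈ endpoints M′ ⊎ v ∈ endpoints M′)

  extend-spec : ∀ {vs} u v M → u ∈ vs → v ∈ vs → Matching vs M → Extended vs u v M (extend (u , v) M)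
  extend-spec {vs} u v M u∈ v∈ match = if-elim (Extended vs u v M)
    (u ~? v ×-dec (¬? (u ∈? endpoints M) ×-dec ¬? (v ∈? endpoints M))) added kept
    where
    added : u ~ v × u ∉ endpoints M × v ∉ endpoints M → Extended vs u v M ((u , v) ∷ M)
    added (u~v , u∉ , v∉) = record
      { edges = u~v ∷ edges match
      ; disjoint = ((λ { refl → ~-irrefl u u~v }) ∷ All.¬Any⇒All¬ _ u∉) ∷ All.¬Any⇒All¬ _ v∉ ∷ disjoint match
      ; within = λ { (here refl) → u∈ ; (there (here refl)) → v∈ ; (there (there w∈)) → within match w∈ }
      } , (λ w∈ → there (there w∈)) , λ _ → inj₁ (here refl)
    kept : ¬ (u ~ v × u ∉ endpoints M × v ∉ endpoints M) → Extended vs u v M M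
    kept blocked = match , id , λ u~v → covered u~v (u ∈? endpoints M) (v ∈? endpoints M)
      where
      covered : u ~ v → Dec (u ∈ endpoints M) → Dec (v ∈ endpoints M) → u ∈ endpoints M ⊎ v ∈ endpoints M
      covered u~v (yes u∈M) _         = inj₁ u∈M
      covered u~v (no  u∉M) (yes v∈M) = inj₂ v∈M
      covered u~v (no  u∉M) (no  v∉M) = contradiction (u~v , u∉M , v∉M) blocked

  -- Matched vertices stay matched, so an edge that was covered when its pair was scanned remains
  -- covered.
  greedy-spec : ∀ {vs} es → All (λ (u , v) → u ∈ vs × v ∈ vs) es →
    let M = foldr extend [] es in
    Matching vs M × (∀ {u v} → (u , v) ∈ es → u ~ v → u ∈ endpoints M ⊎ v ∈ endpoints M)
  greedy-spec []       [] = record { edges = [] ; disjoint = [] ; within = λ () } , λ ()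
  greedy-spec {vs} ((u , v) ∷ es) ((u∈ , v∈) ∷ es⊆)
    with foldr extend [] es | greedy-spec {vs} es es⊆
  ... | M | match , maximal with extend (u , v) M | extend-spec u v M u∈ v∈ match
  ... | M′ | match′ , M⊆M′ , covered = match′ , λ
    { (here refl) u~v → covered u~v
    ; (there e∈)  u~v → [ inj₁ ∘ M⊆M′ , inj₂ ∘ M⊆M′ ]′ (maximal e∈ u~v) }

  module _ (limit : ℕ) (items bidders : List ℕ) where

    record Bid (J : List (ℕ × ℕ)) (v u : ℕ) : Set where
      field
        bidder∈    : u ∈ bidders
        unserved-u : u ∉ map proj₂ (sold J)
        item∈      : v ∈ items
        edge       : u ~ v
        below      : price J v < limit
        cheapest-v : ∀ {w} → w ∈ items → u ~ w → price J v ≤ price J w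

    Step : List (ℕ × ℕ) → List (ℕ × ℕ) → Set
    Step J J′ = J′ ≡ J ⊎ ∃₂ λ v u → J′ ≡ (v , u) ∷ J × Bid J v u

    bid-spec : ∀ J → Step J (bid limit items bidders J)
    bid-spec J = caseList-elim (Step J) (unserved bidders J) (λ _ → inj₁ refl) λ u us I-eq →
      caseList-elim (Step J) (affordable limit items J u) (λ _ → inj₁ refl) λ v vs S-eq →
      inj₂ (cheapest J v vs , u , refl , bid-found u us v vs I-eq S-eq)
      where
      unserved? = λ u → ¬? (u ∈? map proj₂ (sold J))
      affordable? = λ u v → (u ~? v) ×-dec (price J v <? limit)
      bid-found : ∀ u us v vs → unserved bidders J ≡ u ∷ us → affordable limit items J u ≡ v ∷ vs →
                  Bid J (cheapest J v vs) u
      bid-found u us v vs I-eq S-eq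
        with ∈-filter-∷ unserved? I-eq (here refl) | ∈-filter-∷ (affordable? u) S-eq (cheapest-∈ J v vs)
      ... | u∈ , u∉sold | c∈ , u~c , c< = record
        { bidder∈ = u∈ ; unserved-u = u∉sold ; item∈ = c∈ ; edge = u~c ; below = c<
        ; cheapest-v = λ {w} w∈ u~w → minimal w∈ u~w (price J w <? limit) }
        where
        minimal : ∀ {w} → w ∈ items → u ~ w → Dec (price J w < limit) → price J (cheapest J v vs) ≤ price J w
        minimal w∈ u~w (yes w<) = cheapest-≤ J v vs (subst (_ ∈_) S-eq (∈-filter⁺ (affordable? u) w∈ (u~w , w<)))
        -- The minimum was taken over affordable neighbours only; all others cost at least `limit`.
        minimal w∈ u~w (no  w≮) = ≤-trans (<⇒≤ c<) (≮⇒≥ w≮)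

    Stuck : List (ℕ × ℕ) → Set
    Stuck J = ∀ u us → unserved bidders J ≡ u ∷ us → ∀ {w} → w ∈ items → u ~ w → limit ≤ price J w

    -- An affordable neighbour would make the history longer.
    fixed⇒stuck : ∀ J → bid limit items bidders J ≡ J → Stuck J
    fixed⇒stuck J fixed u us I-eq {w} w∈ u~w = ≮⇒≥ λ w< → no-change w< (trans (sym unfold) fixed)
      where
      affordable? = λ v → (u ~? v) ×-dec (price J v <? limit)
      unfold : bid limit items bidders J ≡
               caseList (affordable limit items J u) J (λ v vs → (cheapest J v vs , u) ∷ J)
      unfold = cong (λ I → caseList I J (λ u _ → caseList (affordable limit items J u) J
                           (λ v vs → (cheapest J v vs , u) ∷ J))) I-eq
      no-change : price J w < limit →
                  caseList (affordable limit items J u) J (λ v vs → (cheapest J v vs , u) ∷ J) ≢ J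
      no-change w< = caseList-elim (_≢ J) (affordable limit items J u)
        (λ none _ → filter≡[]⇒none affordable? none w∈ (u~w , w<))
        (λ v vs _ eq → 1+n≢n (cong length eq))

    -- stable is the approximate complementary slackness of the auction.
    record Valid (J : List (ℕ × ℕ)) : Set where
      field
        buyers-unique : Unique (map proj₂ (sold J))
        bid-on        : All (λ (v , u) → u ~ v × v ∈ items × u ∈ bidders) J
        stable        : ∀ {v u} → (v , u) ∈ sold J → ∀ {w} → w ∈ items → u ~ w → price J v ≤ suc (price J w)
        bounded       : ∀ v → price J v ≤ limit

    open Valid

    valid-[] : Valid []
    valid-[] = record { buyers-unique = [] ; bid-on = [] ; stable = λ () ; bounded = λ _ → z≤n }

    -- Stability for the new buyer holds because his item was cheapest and rose by one. The other
    -- buyers' items keep their prices, the former buyer of `v` having dropped out, while what they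
    -- are compared with can only rise.
    valid-∷ : ∀ {J v u} → Valid J → Bid J v u → Valid ((v , u) ∷ J)
    valid-∷ {J} {v} {u} V B = record
      { buyers-unique = All.tabulate u≢ ∷ filter-unique-on proj₂ (≢item? v) (buyers-unique V)
      ; bid-on = (edge , item∈ , bidder∈) ∷ bid-on V
      ; stable = stable′
      ; bounded = λ w → bounded′ w (w ≟ v)
      }
      where
      open Bid B
      u≢ : ∀ {x} → x ∈ map proj₂ (filter (≢item? v) (sold J)) → u ≢ x
      u≢ x∈ refl with ∈-map⁻ proj₂ x∈
      ... | c , c∈ , refl = unserved-u (∈-map⁺ proj₂ (proj₁ (∈-filter⁻ (≢item? v) c∈)))
      stable′ : ∀ {x y} → (x , y) ∈ sold ((v , u) ∷ J) → ∀ {w} → w ∈ items → y ~ w →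
                price ((v , u) ∷ J) x ≤ suc (price ((v , u) ∷ J) w)
      stable′ (here refl) {w} w∈ y~w = ≤-trans (≤-reflexive (price-∷-≡ v u J))
        (s≤s (≤-trans (cheapest-v w∈ y~w) (price-mono v u J w)))
      stable′ (there c∈) {w} w∈ y~w with ∈-filter⁻ (≢item? v) {xs = sold J} c∈
      ... | c∈sold , x≢v = ≤-trans (≤-reflexive (price-∷-≢ u J x≢v))
        (≤-trans (stable V c∈sold w∈ y~w) (s≤s (price-mono v u J w)))
      bounded′ : ∀ w → Dec (w ≡ v) → price ((v , u) ∷ J) w ≤ limit
      bounded′ w (yes refl) = ≤-trans (≤-reflexive (price-∷-≡ v u J)) below
      bounded′ w (no  w≢v)  = ≤-trans (≤-reflexive (price-∷-≢ u J w≢v)) (bounded V w)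

    -- Either every round so far has added a bid, or the history has reached a fixed point, which no
    -- later round leaves.
    auction-spec : ∀ F → let J = auction limit items bidders F in
      Valid J × (length J ≡ length F ⊎ bid limit items bidders J ≡ J)
    auction-spec []      = valid-[] , inj₁ refl
    auction-spec (f ∷ F) = step (auction limit items bidders F) (auction-spec F)
      (bid limit items bidders (auction limit items bidders F)) refl (bid-spec (auction limit items bidders F))
      where
      step : ∀ J → Valid J × (length J ≡ length F ⊎ bid limit items bidders J ≡ J) →
             ∀ J′ → J′ ≡ bid limit items bidders J → Step J J′ →
             Valid J′ × (length J′ ≡ suc (length F) ⊎ bid limit items bidders J′ ≡ J′)
      step J (V , _)              J′ eq (inj₁ refl)                 = V , inj₂ (sym eq)
      step J (V , inj₁ len)       J′ eq (inj₂ (v , u , refl , B))   = valid-∷ V B , inj₁ (cong suc len)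
      step J (V , inj₂ fixed)     J′ eq (inj₂ (v , u , refl , B))   = contradiction (cong length (trans eq fixed)) 1+n≢n

    auction-stuck : ∀ F → length items * limit < length F → Stuck (auction limit items bidders F)
    auction-stuck F small with auction-spec F
    ... | V , inj₂ fixed = fixed⇒stuck _ fixed
    ... | V , inj₁ len   = contradiction
      (length-bids≤ limit items (auction limit items bidders F) (All.map (proj₁ ∘ proj₂) (bid-on V)) (bounded V))
      (<⇒≱ (<-≤-trans small (≤-reflexive (sym len))))

  open Valid

  record Reduction (s s′ : List ℕ × ℕ) : Set where
    field
      unique    : Unique (proj₁ s′)
      parameter≤ : proj₂ s′ ≤ proj₂ s
      forward   : Capacity≥ (proj₁ s) (proj₂ s) → Capacity≥ (proj₁ s′) (proj₂ s′)
      backward  : Capacity≥ (proj₁ s′) (proj₂ s′) → Capacity≥ (proj₁ s) (proj₂ s)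
      shrinks   : length (proj₁ s′) < length (proj₁ s)

  yes-reduction : ∀ {vs k} → 0 < length vs → Capacity≥ vs k → Reduction (vs , k) ([] , 0)
  yes-reduction 0<n cap = record
    { unique = [] ; parameter≤ = z≤n ; forward = λ _ → capacity≥0 [] ; backward = λ _ → cap ; shrinks = 0<n }

  module _ {vs : List ℕ} {M : List (ℕ × ℕ)} (vs! : Unique vs) (match : Matching vs M)
           (maximal : ∀ {u v} → u ∈ vs → v ∈ vs → u ~ v → u ∈ endpoints M ⊎ v ∈ endpoints M)
           {J : List (ℕ × ℕ)} (V : Valid (length vs) (endpoints M) (unmatched vs M) J) where

    private
      items bidders : List ℕ
      items = endpoints M
      bidders = unmatched vs M
      n : ℕ
      n = length vs

      unmatched? : ∀ w → Dec (w ∉ items)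
      unmatched? w = ¬? (w ∈? items)

      bidder⁻ : ∀ {u} → u ∈ bidders → u ∈ vs × u ∉ items
      bidder⁻ = ∈-filter⁻ unmatched?

      neighbour∈items : ∀ {u w} → u ∈ bidders → w ∈ vs → u ~ w → w ∈ items
      neighbour∈items u∈ w∈ u~w with bidder⁻ u∈
      ... | u∈vs , u∉ with maximal u∈vs w∈ u~w
      ... | inj₁ u∈items = contradiction u∈items u∉
      ... | inj₂ w∈items = w∈items

      sold-edge : ∀ {v u} → (v , u) ∈ sold J → u ~ v × v ∈ items × u ∈ bidders
      sold-edge b∈ = All.lookup (bid-on V) (sold⊆ J b∈)

      submatching : ∀ X → (∀ {b} → b ∈ X → b ∈ sold J) → Unique (map proj₁ X) → Unique (map proj₂ X) → Matching vs X
      submatching X X⊆ X₁! X₂! = record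
        { edges = All.tabulate λ {(v , u)} b∈ → ~-sym u v (proj₁ (sold-edge (X⊆ b∈)))
        ; disjoint = endpoints-unique X X₁! X₂! λ v∈ u∈ v≡u → proj₂ (bidder⁻ (bidder∈ u∈)) (subst (_∈ items) v≡u (item∈ v∈))
        ; within = λ w∈ → [ within match ∘ item∈ , proj₁ ∘ bidder⁻ ∘ bidder∈ ]′ (∈-endpoints⁻ X w∈)
        }
        where
        item∈ : ∀ {v} → v ∈ map proj₁ X → v ∈ items
        item∈ v∈ with ∈-map⁻ proj₁ v∈
        ... | b , b∈ , refl = proj₁ (proj₂ (sold-edge (X⊆ b∈)))
        bidder∈ : ∀ {u} → u ∈ map proj₂ X → u ∈ bidders
        bidder∈ u∈ with ∈-map⁻ proj₂ u∈
        ... | b , b∈ , refl = proj₂ (proj₂ (sold-edge (X⊆ b∈)))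

      n≤ : n ≤ length items + length bidders
      n≤ = ≤-trans (≤-reflexive (sym (length-filter-split (_∈? items) vs)))
        (+-monoˡ-≤ (length bidders) (unique-⊆⇒length≤ (Unique.filter⁺ (_∈? items) vs!)
          (proj₂ ∘ ∈-filter⁻ (_∈? items) {xs = vs})))

    all-served : ∀ {k} → unserved bidders J ≡ [] → 3 * k ∸ 3 < n → length M < k → Capacity≥ vs k
    all-served {suc k} none large M<k = capacity-antimono {k′ = length (sold J)} k≤
      (matching-bound ~-sym (sold J) (edges sold-matching) (disjoint sold-matching) (within sold-matching))
      where
      sold-matching : Matching vs (sold J)
      sold-matching = submatching (sold J) id (sold-items-unique J) (buyers-unique V)
      served? = λ u → u ∈? map proj₂ (sold J)
      bidders≤ : length bidders ≤ length (sold J)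
      bidders≤ = ≤-trans (unique-⊆⇒length≤ (Unique.filter⁺ unmatched? vs!)
        λ {u} u∈ → decidable-stable (served? u) (filter≡[]⇒none (¬? ∘ served?) none u∈))
        (≤-reflexive (length-map proj₂ (sold J)))
      open ≤-Reasoning
      -- The parameter is `suc k`. If `sold J` had at most `k` edges, the at most `2 * k` items and
      -- `k` bidders would give n ≤ 3 * k, which is `3 * suc k ∸ 3`.
      k≤ : suc k ≤ length (sold J)
      k≤ = ≰⇒> λ sold≤k → <⇒≱ large (begin
        n                               ≤⟨ n≤ ⟩
        length items + length bidders   ≤⟨ +-mono-≤ (≤-trans (≤-reflexive (length-endpoints M))
                                             (+-mono-≤ (s≤s⁻¹ M<k) (s≤s⁻¹ M<k))) (≤-trans bidders≤ sold≤k) ⟩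
        k + k + k                       ≡⟨ +-assoc k k k ⟩
        k + (k + k)                     ≡⟨ cong (λ l → k + (k + l)) (+-identityʳ k) ⟨
        3 * k                           ≡⟨ m+n∸n≡m (3 * k) 3 ⟨
        3 * k + 3 ∸ 3                   ≡⟨ cong (_∸ 3) (trans (*-suc 3 k) (+-comm 3 (3 * k))) ⟨
        3 * suc k ∸ 3                   ∎)

    -- `u` itself is no item. The strictness is what leaves a price unattained and lets the fuel
    -- outlast the bids.
    items<n : ∀ {u} → u ∈ bidders → length items < n
    items<n {u} u∈ = unique-⊆⇒length≤ {xs = u ∷ items} (All.¬Any⇒All¬ items (proj₂ (bidder⁻ u∈)) ∷ disjoint match)
      λ { (here refl) → proj₁ (bidder⁻ u∈) ; (there v∈) → within match v∈ }

    module _ {u j} (u∈ : u ∈ bidders) (stuck : ∀ {w} → w ∈ items → u ~ w → n ≤ price J w)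
             (0<j : 0 < j) (j≤n : j ≤ n) (≢j : ∀ {v} → v ∈ items → price J v ≢ j) where

      private
        X : List (ℕ × ℕ)
        X = above j J
        vs′ : List ℕ
        vs′ = proj₁ (removeCrown vs 0 u X)
        priced? : ∀ (b : ℕ × ℕ) → Dec (j < price J (proj₁ b))
        priced? b = j <? price J (proj₁ b)
        kept? : ∀ w → Dec (w ∉ u ∷ endpoints X)
        kept? w = ¬? (w ∈? u ∷ endpoints X)

        X⊆ : ∀ {b} → b ∈ X → b ∈ sold J × j < price J (proj₁ b)
        X⊆ = ∈-filter⁻ priced? {xs = sold J}

        crown-matching : Matching vs X
        crown-matching = submatching X (proj₁ ∘ X⊆) (filter-unique-on proj₁ priced? (sold-items-unique J))
          (filter-unique-on proj₂ priced? (buyers-unique V))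

        -- As `j` is not attained, the price exceeds `j`; being positive, it belongs to a sold item.
        expensive⇒head : ∀ {w} → w ∈ items → j ≤ price J w → w ∈ map proj₁ X
        expensive⇒head {w} w∈ j≤ with ∈-map⁻ proj₁ (price>0⇒sold J (<-≤-trans 0<j j≤))
        ... | b , b∈ , refl = ∈-map⁺ proj₁ (∈-filter⁺ priced? b∈ (≤∧≢⇒< j≤ (≢j w∈ ∘ sym)))

        Crowned : ℕ → Set
        Crowned v = ∀ w → w ∈ vs → v ~ w → w ∈ map proj₁ X

        crowned-u : Crowned u
        crowned-u w w∈ u~w = let w∈items = neighbour∈items u∈ w∈ u~w in
          expensive⇒head w∈items (≤-trans j≤n (stuck w∈items u~w))

        crowned-buyer : ∀ {v t} → (v , t) ∈ X → Crowned t
        crowned-buyer {v} {t} b∈ w w∈ t~w =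
          let (b∈sold , j<) = X⊆ b∈
              (_ , _ , t∈) = sold-edge b∈sold
              w∈items = neighbour∈items t∈ w∈ t~w
          -- From j < price of `v` ≤ 1 + price of `w` follows only j ≤ price of `w`; the gap makes
          -- up for the lost unit.
          in expensive⇒head w∈items (s≤s⁻¹ (≤-trans j< (stable V b∈sold w∈items t~w)))

        cover : ∀ v → v ∈ vs → v ∈ vs′ ⊎ v ∈ map proj₁ X ⊎ Crowned v
        cover v v∈ with v ∈? u ∷ endpoints X
        ... | no  v∉          = inj₁ (∈-filter⁺ kept? v∈ v∉)
        ... | yes (here refl) = inj₂ (inj₂ crowned-u)
        ... | yes (there v∈X) with ∈-endpoints⁻ X v∈X
        ...   | inj₁ v∈₁ = inj₂ (inj₁ v∈₁)
        ...   | inj₂ v∈₂ with ∈-map⁻ proj₂ v∈₂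
        ...     | b , b∈ , refl = inj₂ (inj₂ (crowned-buyer b∈))

        vs′! : Unique vs′
        vs′! = Unique.filter⁺ kept? vs!

        X++vs′! : Unique (endpoints X ++ vs′)
        X++vs′! = Unique.++⁺ (disjoint crown-matching) vs′!
          λ (w∈X , w∈vs′) → proj₂ (∈-filter⁻ kept? {xs = vs} w∈vs′) (there w∈X)

        X++vs′⊆vs : ∀ {w} → w ∈ endpoints X ++ vs′ → w ∈ vs
        X++vs′⊆vs w∈ = [ within crown-matching , proj₁ ∘ ∈-filter⁻ kept? ]′ (∈-++⁻ (endpoints X) w∈)

        vs′<vs : length vs′ < length vs
        vs′<vs = unique-⊆⇒length≤ {xs = u ∷ vs′}
          (All.¬Any⇒All¬ vs′ (λ u∈vs′ → proj₂ (∈-filter⁻ kept? {xs = vs} u∈vs′) (here refl)) ∷ vs′!)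
          λ { (here refl) → proj₁ (bidder⁻ u∈) ; (there v∈) → proj₁ (∈-filter⁻ kept? v∈) }

      crown-reduction : ∀ k → Reduction (vs , k) (removeCrown vs k u X)
      crown-reduction k = record
        { unique = vs′! ; parameter≤ = m∸n≤m k (length X)
        ; forward = proj₁ equivalence ; backward = proj₂ equivalence ; shrinks = vs′<vs }
        where
        equivalence : (Capacity≥ vs k → Capacity≥ vs′ (k ∸ length X)) × (Capacity≥ vs′ (k ∸ length X) → Capacity≥ vs k)
        equivalence = crown-equivalence ~-sym X (edges crown-matching) X++vs′! X++vs′⊆vs cover

  reduceBy-spec : ∀ {vs M} → Unique vs → Matching vs M →
    (∀ {u v} → u ∈ vs → v ∈ vs → u ~ v → u ∈ endpoints M ⊎ v ∈ endpoints M) →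
    ∀ k → 3 * k ∸ 3 < length vs → length M < k → Reduction (vs , k) (reduceBy vs k M)
  reduceBy-spec {vs} {M} vs! match maximal k large M<k = conclude (bids vs M)
    (proj₁ (auction-spec n items bidders fuel)) (auction-stuck n items bidders fuel)
    where
    n : ℕ
    n = length vs
    items bidders : List ℕ
    items = endpoints M
    bidders = unmatched vs M
    fuel : List (ℕ × ℕ)
    fuel = cartesianProduct vs vs
    conclude : ∀ J → Valid n items bidders J → (length items * n < length fuel → Stuck n items bidders J) →
      Reduction (vs , k) (caseList (unserved bidders J) ([] , 0) λ u _ → removeCrown vs k u (above (gap n items J) J))
    conclude J V stuck = caseList-elim (Reduction (vs , k)) (unserved bidders J)
      (λ none → yes-reduction (≤-trans (s≤s z≤n) large) (all-served vs! match maximal V none large M<k))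
      λ u us eq →
        let u∈ = proj₁ (∈-filter-∷ (λ u → ¬? (u ∈? map proj₂ (sold J))) {xs = bidders} eq (here refl))
            few = items<n vs! match maximal V u∈
            (0<j , j≤n , ≢j) = gap-spec n items J few
            enough = subst (length items * n <_) (sym (length-cartesianProduct vs vs))
              (*-monoˡ-< n {{>-nonZero (≤-trans (s≤s z≤n) few)}} few)
        in crown-reduction vs! match maximal V u∈ (stuck enough u us eq) 0<j j≤n ≢j k

  Small : List ℕ × ℕ → Set
  Small s = length (proj₁ s) ≤ 3 * proj₂ s ∸ 3

  opaque
    unfolding reduceLarge

    reduceLarge-spec : ∀ s {M} → ¬ Small s → Unique (proj₁ s) → Matching (proj₁ s) M →
      (∀ {u v} → u ∈ proj₁ s → v ∈ proj₁ s → u ~ v → u ∈ endpoints M ⊎ v ∈ endpoints M) → Reduction s (reduceLarge s M)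
    reduceLarge-spec s@(vs , k) {M} large vs! match maximal = if-elim (Reduction s) (k ≤? length M) {[] , 0} {reduceBy vs k M}
      (λ k≤ → yes-reduction (≤-trans (s≤s z≤n) (≰⇒> large)) (capacity-antimono {k′ = length M} k≤
        (matching-bound ~-sym M (edges match) (disjoint match) (within match))))
      (λ k≰ → reduceBy-spec vs! match maximal k (≰⇒> large) (≰⇒> k≰))

  greedyMatching-spec : ∀ vs → let M = greedyMatching vs in
    Matching vs M × (∀ {u v} → u ∈ vs → v ∈ vs → u ~ v → u ∈ endpoints M ⊎ v ∈ endpoints M)
  greedyMatching-spec vs =
    let (match , maximal) = greedy-spec {vs} (cartesianProduct vs vs) (All.tabulate (∈-cartesianProduct⁻ vs vs))
    in match , λ u∈ v∈ → maximal (∈-cartesianProduct⁺ u∈ v∈)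

  unless-small : ∀ s {s′} (d : Dec (Small s)) → (¬ Small s → Reduction s s′) →
    let s″ = if does d then s else s′ in (Small s × s″ ≡ s) ⊎ (¬ Small s × Reduction s s″)
  unless-small s (yes small) _      = inj₁ (small , refl)
  unless-small s (no  large) reduct = inj₂ (large , reduct large)

  reduce-spec : ∀ s → Unique (proj₁ s) → (Small s × reduce s ≡ s) ⊎ (¬ Small s × Reduction s (reduce s))
  reduce-spec s vs! = unless-small s {reduceLarge s (greedyMatching (proj₁ s))} (length (proj₁ s) ≤? 3 * proj₂ s ∸ 3)
    λ large → let (match , maximal) = greedyMatching-spec (proj₁ s) in reduceLarge-spec s large vs! match maximal

  -- `progress` is the termination argument: either the size bound is reached, or every round has
  -- cost a vertex.
  record Kernelized (s s′ : List ℕ × ℕ) (fuel : ℕ) : Set where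
    field
      unique     : Unique (proj₁ s′)
      parameter≤ : proj₂ s′ ≤ proj₂ s
      forward    : Capacity≥ (proj₁ s) (proj₂ s) → Capacity≥ (proj₁ s′) (proj₂ s′)
      backward   : Capacity≥ (proj₁ s′) (proj₂ s′) → Capacity≥ (proj₁ s) (proj₂ s)
      progress   : Small s′ ⊎ length (proj₁ s′) + fuel ≤ length (proj₁ s)

  module _ (f : List ℕ × ℕ → List ℕ × ℕ)
           (f-spec : ∀ s → Unique (proj₁ s) → (Small s × f s ≡ s) ⊎ (¬ Small s × Reduction s (f s))) where

    iterate-spec : ∀ s → Unique (proj₁ s) → (fuel : List ℕ) →
                   Kernelized s (foldr (λ _ → f) s fuel) (length fuel)
    iterate-spec s s! [] = record
      { unique = s! ; parameter≤ = ≤-refl ; forward = id ; backward = id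
      ; progress = inj₂ (≤-reflexive (+-identityʳ _)) }
    iterate-spec s s! (_ ∷ fuel) = step (foldr (λ _ → f) s fuel) (iterate-spec s s! fuel)
      where
      step : ∀ s′ → Kernelized s s′ (length fuel) → Kernelized s (f s′) (suc (length fuel))
      step s′ K = advance (f s′) (f-spec s′ (Kernelized.unique K))
        where
        open Kernelized K
        advance : ∀ s″ → (Small s′ × s″ ≡ s′) ⊎ (¬ Small s′ × Reduction s′ s″) → Kernelized s s″ (suc (length fuel))
        advance s″ (inj₁ (small , refl)) = record
          { unique = unique ; parameter≤ = parameter≤ ; forward = forward ; backward = backward ; progress = inj₁ small }
        advance s″ (inj₂ (large , R)) = record
          { unique = Reduction.unique R ; parameter≤ = ≤-trans (Reduction.parameter≤ R) parameter≤
          ; forward = Reduction.forward R ∘ forward ; backward = backward ∘ Reduction.backward R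
          ; progress = shrink progress }
          where
          shrink : Small s′ ⊎ length (proj₁ s′) + length fuel ≤ length (proj₁ s) →
                   Small s″ ⊎ length (proj₁ s″) + suc (length fuel) ≤ length (proj₁ s)
          shrink (inj₂ ≤n)    = inj₂ (≤-trans (≤-reflexive (+-suc _ _)) (≤-trans (+-monoˡ-≤ (length fuel) (Reduction.shrinks R)) ≤n))
          shrink (inj₁ small) = contradiction small large

  kernelize-spec : ∀ n k → Kernelized (downFrom n , k) (kernelize n k) (length (downFrom n))
  kernelize-spec n k = iterate-spec reduce reduce-spec (downFrom n , k) (Unique.downFrom⁺ n) (downFrom n)

-- Encoding of graphs

adjacencyMatrix : Graph → Matrix
adjacencyMatrix G = tabulate λ i → tabulate λ j → adjacent G i j

⌜adjacencyMatrix⌝ : ∀ G → ⌜ adjacencyMatrix G ⌝ ≡ encodeGraph G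
⌜adjacencyMatrix⌝ G = cong encodeList (trans (map-tabulate (λ i → tabulate (adjacent G i)) ⌜_⌝)
  (tabulate-cong λ i → cong encodeList (map-tabulate (adjacent G i) ⌜_⌝)))

drop-tabulate : ∀ {A : Set} {n} (d : A) (f : Fin n → A) i → caseList (drop (toℕ i) (tabulate f)) d (λ x _ → x) ≡ f i
drop-tabulate d f zero    = refl
drop-tabulate d f (suc i) = drop-tabulate d (f ∘ suc) i

drop-length : ∀ {A : Set} {n m} (f : Fin n → A) → n ≤ m → drop m (tabulate f) ≡ []
drop-length {n = zero}  {m}     f _         = drop-[] m
drop-length {n = suc n} {suc m} f (s≤s n≤m) = drop-length (f ∘ suc) n≤m

module _ (G : Graph) where

  private
    A : Matrix
    A = adjacencyMatrix G


    row : Fin (order G) → List Bool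
    row i = tabulate (adjacent G i)

    rowOrEmpty : ℕ → List Bool
    rowOrEmpty u = caseList (drop u A) [] (λ r _ → r)

    bitOrFalse : ℕ → List Bool → Bool
    bitOrFalse v r = caseList (drop v r) false (λ b _ → b)

  entry-adjacent : ∀ i j → adjacent G i j ≡ entry A (toℕ i) (toℕ j)
  entry-adjacent i j = sym (trans (cong (bitOrFalse (toℕ j)) (drop-tabulate [] row i))
    (drop-tabulate false (adjacent G i) j))

  -- Transfers symmetry and looplessness from the graph to `entry`, which is used at arbitrary
  -- numbers.
  entry⇒vertices : ∀ u v → T (entry A u v) → ∃[ i ] ∃[ j ] (toℕ i ≡ u × toℕ j ≡ v × T (adjacent G i j))
  entry⇒vertices u v uv with u <? order G
  ... | no u≮ = contradiction (subst T (trans (cong (λ r → bitOrFalse v (caseList r [] (λ x _ → x)))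
                  (drop-length row (≮⇒≥ u≮))) (cong (λ r → caseList r false (λ b _ → b)) (drop-[] v))) uv) id
  ... | yes u< with v <? order G
  ... | no v≮ = contradiction (subst T (trans (cong (bitOrFalse v) row≡)
                  (cong (λ r → caseList r false (λ b _ → b)) (drop-length (adjacent G (fromℕ< u<)) (≮⇒≥ v≮)))) uv) id
    where
    row≡ : rowOrEmpty u ≡ row (fromℕ< u<)
    row≡ = trans (cong rowOrEmpty (sym (toℕ-fromℕ< u<))) (drop-tabulate [] row (fromℕ< u<))
  ... | yes v< = fromℕ< u< , fromℕ< v< , toℕ-fromℕ< u< , toℕ-fromℕ< v< ,
    subst T (trans (cong₂ (entry A) (sym (toℕ-fromℕ< u<)) (sym (toℕ-fromℕ< v<)))
                   (sym (entry-adjacent (fromℕ< u<) (fromℕ< v<)))) uv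

  entry-sym : ∀ u v → T (entry A u v) → T (entry A v u)
  entry-sym u v uv with entry⇒vertices u v uv
  ... | i , j , refl , refl , ij = subst T (trans (symmetric G i j) (entry-adjacent j i)) ij

  entry-irrefl : ∀ u → ¬ T (entry A u u)
  entry-irrefl u uu with entry⇒vertices u u uu
  ... | i , j , refl , j≡i , ij with toℕ-injective j≡i
  ... | refl = subst T (loopless G i) ij

  T-ext : ∀ {x y} → (T x → T y) → (T y → T x) → x ≡ y
  T-ext {true}  {true}  f g = refl
  T-ext {true}  {false} f g = contradiction (f _) id
  T-ext {false} {true}  f g = contradiction (g _) id
  T-ext {false} {false} f g = refl

  induced : List ℕ → Graph
  induced vs = record
    { order     = length vs
    ; adjacent  = λ i j → entry A (lookup vs i) (lookup vs j)
    ; symmetric = λ i j → T-ext (entry-sym (lookup vs i) (lookup vs j)) (entry-sym (lookup vs j) (lookup vs i))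
    ; loopless  = λ i → T-ext {y = false} (entry-irrefl (lookup vs i)) (λ ())
    }

inducedMatrix : Matrix → List ℕ → Matrix
inducedMatrix A vs = map (λ u → map (entry A u) vs) vs

map-lookup : ∀ {A B : Set} (f : A → B) xs → tabulate (f ∘ lookup xs) ≡ map f xs
map-lookup f xs = trans (sym (map-tabulate (lookup xs) f)) (cong (map f) (tabulate-lookup xs))

adjacencyMatrix-induced : ∀ G vs → adjacencyMatrix (induced G vs) ≡ inducedMatrix (adjacencyMatrix G) vs
adjacencyMatrix-induced G vs = trans (tabulate-cong λ i → map-lookup (entry (adjacencyMatrix G) (lookup vs i)) vs)
  (map-lookup (λ u → map (entry (adjacencyMatrix G) u) vs) vs)

lookup-injective : ∀ {A : Set} {xs : List A} → Unique xs → ∀ {i j} → lookup xs i ≡ lookup xs j → i ≡ j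
lookup-injective (x∉ ∷ xs!) {zero}  {zero}  eq = refl
lookup-injective (x∉ ∷ xs!) {zero}  {suc j} eq = contradiction eq (All.lookup x∉ (∈-lookup j))
lookup-injective (x∉ ∷ xs!) {suc i} {zero}  eq = contradiction (sym eq) (All.lookup x∉ (∈-lookup i))
lookup-injective (x∉ ∷ xs!) {suc i} {suc j} eq = cong suc (lookup-injective xs! eq)

size-tabulate : ∀ {n} (f : Fin n → Tree) b → (∀ i → size (f i) ≤ b) → size (encodeList (tabulate f)) ≤ 1 + n * suc b
size-tabulate {zero}  f b f≤ = ≤-refl
size-tabulate {suc n} f b f≤ = s≤s (≤-trans (+-mono-≤ (f≤ zero) (size-tabulate (f ∘ suc) b (f≤ ∘ suc)))
  (≤-reflexive (+-suc b (n * suc b))))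

size-encodeGraph : ∀ G → size (encodeGraph G) ≤ 1 + order G * (2 + order G * 4)
size-encodeGraph G = size-tabulate _ (1 + order G * 4) λ i →
  size-tabulate _ 3 λ j → size-Bool (adjacent G i j)

-- The bracket bounds the encoding of a matrix with 3k rows, counting 4 for each bit with its list
-- node; the final `k` makes the sum bound the new parameter as well.
kernelBound : ℕ → ℕ
kernelBound k = (1 + 3 * k * (2 + 3 * k * 4)) + k

kernelBoundᶠ : Feasible kernelBound
kernelBoundᶠ = (constᶠ 1 +ᶠ ((constᶠ 3 *ᶠ idᶠ) *ᶠ (constᶠ 2 +ᶠ ((constᶠ 3 *ᶠ idᶠ) *ᶠ constᶠ 4)))) +ᶠ idᶠ

computable : ∀ {h : ℕ → ℕ} → Feasible h → Computable h
computable H = prog H , λ n → let (t , p , _) = halts H n in t , p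

opaque

  kernelState : Matrix × ℕ → List ℕ × ℕ
  kernelState (A , k) = Search.kernelize A (length A) k

  kernelStateᶠ : Feasible kernelState
  kernelStateᶠ = kernelizeᶠ fstᶠ (lengthᶠ fstᶠ) sndᶠ

  kernelState-spec : ∀ p G k → let open Correctness (adjacencyMatrix G) p (entry-sym G) (entry-irrefl G) in
    Kernelized (downFrom (order G) , k) (kernelState (adjacencyMatrix G , k)) (order G)
  kernelState-spec p G k = subst (Kernelized (downFrom (order G) , k) (kernelState (adjacencyMatrix G , k)))
    (length-downFrom (order G))
    (subst (λ n → Kernelized (downFrom (order G) , k) (Search.kernelize A n k) (length (downFrom (order G))))
      (sym (length-tabulate (λ i → tabulate (adjacent G i)))) (kernelize-spec (order G) k))
    where
    A : Matrix
    A = adjacencyMatrix G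
    open Correctness A p (entry-sym G) (entry-irrefl G)

outputᶠ : Feasible {Matrix × (List ℕ × ℕ)} {Matrix × ℕ} (λ (A , s) → inducedMatrix A (proj₁ s) , proj₂ s)
outputᶠ = mapᶠ {f = λ (A , s) u → map (entry A u) (proj₁ s)}
    (mapᶠ {f = λ ((A , s) , u) v → entry A u v} (entryᶠ (fstᶠ ∘ᶠ fstᶠ ∘ᶠ fstᶠ) (sndᶠ ∘ᶠ fstᶠ) sndᶠ) (fstᶠ ∘ᶠ sndᶠ ∘ᶠ fstᶠ))
    (fstᶠ ∘ᶠ sndᶠ)
  ,ᶠ (sndᶠ ∘ᶠ sndᶠ)

opaque

  kernelᶠ : Feasible {Matrix × ℕ} {Matrix × ℕ} (λ I → inducedMatrix (proj₁ I) (proj₁ (kernelState I)) , proj₂ (kernelState I))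
  kernelᶠ = outputᶠ ∘ᶠ (fstᶠ ,ᶠ kernelStateᶠ)

-- The kernelization

kernelOf : Graph × ℕ → Graph × ℕ
kernelOf (G , k) = induced G (proj₁ s) , proj₂ s
  where s = kernelState (adjacencyMatrix G , k)

⌜kernelOf⌝ : ∀ G k → let (G′ , k′) = kernelOf (G , k) in
  ⌜ inducedMatrix (adjacencyMatrix G) (proj₁ (kernelState (adjacencyMatrix G , k))) ⌝ ≡ encodeGraph G′
⌜kernelOf⌝ G k = trans (cong ⌜_⌝ (sym (adjacencyMatrix-induced G vs))) (⌜adjacencyMatrix⌝ (induced G vs))
  where vs = proj₁ (kernelState (adjacencyMatrix G , k))

kernel-polytime : ∃[ c ] ∃[ d ] (∀ (I : Graph × ℕ) → ∃[ t ]
  (prog kernelᶠ ⊢ node (encodeGraph (proj₁ I)) (encodeℕ (proj₂ I)) ⇓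
                  node (encodeGraph (proj₁ (kernelOf I))) (encodeℕ (proj₂ (kernelOf I))) [ t ]
   × t ≤ c * size (node (encodeGraph (proj₁ I)) (encodeℕ (proj₂ I))) ^ d))
kernel-polytime =
  let (c , d , ≤monomial) = ⟦⟧-monomial (cost kernelᶠ) in
  c , d , λ (G , k) →
    let (t , run , t≤) = halts kernelᶠ (adjacencyMatrix G , k) in
    t , subst₂ (λ x y → prog kernelᶠ ⊢ node x ⌜ k ⌝ ⇓ node y ⌜ proj₂ (kernelOf (G , k)) ⌝ [ t ])
          (⌜adjacencyMatrix⌝ G) (⌜kernelOf⌝ G k) run ,
    subst (λ x → t ≤ c * size (node x ⌜ k ⌝) ^ d) (⌜adjacencyMatrix⌝ G)
      (≤-trans t≤ (≤monomial ⟪ (adjacencyMatrix G , k) ⟫ (s≤s z≤n)))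

module _ (p : ℕ) (G : Graph) (k : ℕ) where

  private
    A : Matrix
    A = adjacencyMatrix G
    vs : List ℕ
    vs = proj₁ (kernelState (A , k))

    k′ : ℕ
    k′ = proj₂ (kernelState (A , k))

  open Correctness A p (entry-sym G) (entry-irrefl G)
  open Kernelized (kernelState-spec p G k)
  open Capacity (entry A) p

  kernel-order≤ : length vs ≤ 3 * k′ ∸ 3
  kernel-order≤ with progress
  ... | inj₁ small = small
  -- As many vertices as there were have been lost, so none is left.
  ... | inj₂ ≤n    = ≤-trans (+-cancelʳ-≤ (order G) (length vs) 0 (≤-trans ≤n (≤-reflexive (length-downFrom (order G))))) z≤n

  kernel-parameter≤ : k′ ≤ k
  kernel-parameter≤ = parameter≤

  kernel-equivalent : Cap≥ (suc p) G k ⇔ Cap≥ (suc p) (induced G vs) k′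
  kernel-equivalent = mk⇔
    (λ cap → from′ k′ (forward (to k cap)))
    (λ cap → from k (backward (to′ k′ cap)))
    where
    toℕ-onto : ∀ {v} → v ∈ downFrom (order G) → ∃[ i ] toℕ {order G} i ≡ v
    toℕ-onto v∈ = fromℕ< (∈-downFrom⁻ v∈) , toℕ-fromℕ< (∈-downFrom⁻ v∈)
    toℕ-∈ : ∀ (i : Fin (order G)) → toℕ i ∈ downFrom (order G)
    toℕ-∈ i = ∈-downFrom⁺ (toℕ<n i)
    lookup-onto : ∀ {v} → v ∈ vs → ∃[ i ] lookup vs i ≡ v
    lookup-onto v∈ = Any.index v∈ , sym (Any.lookup-index v∈)
    to = cap≥⇒capacity≥ (entry A) p G toℕ (downFrom (order G)) toℕ-injective toℕ-∈ toℕ-onto (entry-adjacent G)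
    from = capacity≥⇒cap≥ (entry A) p G toℕ (downFrom (order G)) toℕ-injective toℕ-∈ toℕ-onto (entry-adjacent G)
    to′ = cap≥⇒capacity≥ (entry A) p (induced G vs) (lookup vs) vs (lookup-injective unique)
            (∈-lookup {xs = vs}) lookup-onto (λ _ _ → refl)
    from′ = capacity≥⇒cap≥ (entry A) p (induced G vs) (lookup vs) vs (lookup-injective unique)
            (∈-lookup {xs = vs}) lookup-onto (λ _ _ → refl)

  kernel-bounded : size (encodeGraph (induced G vs)) ≤ kernelBound k × k′ ≤ kernelBound k
  kernel-bounded =
    ≤-trans (size-encodeGraph (induced G vs)) (≤-trans (s≤s (*-mono-≤ order≤ (s≤s (s≤s (*-monoˡ-≤ 4 order≤)))))
      (m≤m+n (1 + 3 * k * (2 + 3 * k * 4)) k)) ,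
    ≤-trans parameter≤ (m≤n+m k (1 + 3 * k * (2 + 3 * k * 4)))
    where
    order≤ : length vs ≤ 3 * k
    order≤ = ≤-trans kernel-order≤ (≤-trans (m∸n≤m (3 * k′) 3) (*-monoʳ-≤ 3 parameter≤))

theorem1p1 : ∀ (q : ℕ) → 2 ≤ q →
    Σ[ K ∈ Kernelization (StorageCapacity q) ]
      (∀ (G : Graph) (k : ℕ) →
        let G′ = proj₁ (Kernelization.kernel K (G , k))
            k′ = proj₂ (Kernelization.kernel K (G , k)) in
        order G′ ≤ 3 * k′ ∸ 3 × k′ ≤ k)
theorem1p1 (suc p) _ = kernelization , λ G k → kernel-order≤ p G k , kernel-parameter≤ p G k
  where
  kernelization : Kernelization (StorageCapacity (suc p))
  kernelization = record
    { program    = prog kernelᶠ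
    ; kernel     = kernelOf
    ; polytime   = kernel-polytime
    ; bounded    = kernelBound , computable kernelBoundᶠ , kernel-bounded p
    ; equivalent = kernel-equivalent p
    }
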